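{- Let $\sigma = (\sigma_j)_{j\ge1}$ be an infinite increasing sequence of positive integers with $\sigma_1 \geq 3$, and let $\tau = (\tau_i)_{i\ge1}$ be an arbitrary infinite subsequence of $\sigma$ with $\tau_1 = \sigma_1$. Set $\tau_0 = 1$, $\triangle_1 = 1$, and for $i \ge 2$ let $\triangle_i := \max\{\sigma_j - \sigma_{j-1} : j\ge 2,\ \sigma_j \leq \tau_i\}$. For $r \ge 1$ let $P_r$ be the family of all graphs containing no cycle of any length $\sigma_j$ with $\sigma_j \leq \tau_r$. Then for every $r\ge1$, every $n$-vertex graph $G \in P_r$ satisfies \[ \iota(G) < 27^r \sigma_1 \exp\Bigl(\sum_{i=1}^r \frac{2\log \triangle_i}{\tau_{i-1}} + \frac{2\log n}{\tau_r}\Bigr). \]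
   Context: All graphs are finite and simple. For nonempty $X \subseteq V(G)$, $\alpha(X)$ is the independence number of the subgraph induced by $X$, and $\iota(G) := \sup_{\emptyset\neq X \subseteq V(G)} |X|/\alpha(X)$. $\log$ is the natural logarithm. -}

module Defs where

open import Data.Nat using (ℕ; zero; suc; _+_; _*_; _∸_; _^_; _≤_; _<_; _⊔_; _≤ᵇ_)
open import Data.Bool using (if_then_else_)
open import Data.Nat.Properties using (_≤?_)
open import Data.Fin using (Fin; zero; suc; inject₁; fromℕ)
open import Data.Fin.Subset using (Subset; _∈_; _⊆_; ∣_∣)
open import Data.Product using (Σ; _×_)
open import Data.Empty using (⊥)
open import Relation.Nullary using (¬_; yes; no)
open import Relation.Binary.PropositionalEquality using (_≡_)
open import Function.Definitions using (Injective)

record Graph (n : ℕ) : Set₁ where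
  field
    Adj    : Fin n → Fin n → Set
    sym    : ∀ {u v} → Adj u v → Adj v u
    irrefl : ∀ {u} → ¬ Adj u u
open Graph public

-- G contains a cycle of length k (as a subgraph): k distinct vertices
-- c 0, ..., c (k-1) with c i ~ c (i+1) and c (k-1) ~ c 0.
-- (Only used for k ≥ 3; length 0 is declared absent.)
HasCycle : ∀ {n} → Graph n → ℕ → Set
HasCycle G zero = ⊥
HasCycle {n} G (suc m) =
  Σ (Fin (suc m) → Fin n) λ c →
    Injective _≡_ _≡_ c
    × ((i : Fin m) → Adj G (c (inject₁ i)) (c (suc i)))
    × Adj G (c (fromℕ m)) (c zero)

Independent : ∀ {n} → Graph n → Subset n → Subset n → Set
Independent G X I = I ⊆ X × (∀ {u v} → u ∈ I → v ∈ I → ¬ Adj G u v)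

IsIndepNumber : ∀ {n} → Graph n → Subset n → ℕ → Set
IsIndepNumber G X a =
  (Σ (Subset _) λ I → Independent G X I × ∣ I ∣ ≡ a)
  × (∀ I → Independent G X I → ∣ I ∣ ≤ a)

-- Sequences are indexed from 1 (value at index 0 is irrelevant).
-- τ is given via an index map φ: τ_i = σ_{φ i} for i ≥ 1, and τ_0 = 1.
tau : (ℕ → ℕ) → (ℕ → ℕ) → ℕ → ℕ
tau σ φ zero    = 1
tau σ φ (suc i) = σ (φ (suc i))

maxGapUpTo : (ℕ → ℕ) → ℕ → ℕ → ℕ
maxGapUpTo σ B zero = 0
maxGapUpTo σ B (suc zero) = 0
maxGapUpTo σ B (suc (suc k)) =
  maxGapUpTo σ B (suc k) ⊔ (if σ (suc (suc k)) ≤ᵇ B then σ (suc (suc k)) ∸ σ (suc k) else 0)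

-- △_1 = 1; for i ≥ 2, △_i = max { σ_j − σ_{j−1} : j ≥ 2, σ_j ≤ τ_i }.
-- Since σ is increasing with σ_1 ≥ 3, σ_j ≥ j, so every j with σ_j ≤ τ_i
-- satisfies j ≤ τ_i; hence ranging over 2 ≤ j ≤ τ_i is exhaustive.
delta : (ℕ → ℕ) → (ℕ → ℕ) → ℕ → ℕ
delta σ φ zero          = 1   -- unused
delta σ φ (suc zero)    = 1
delta σ φ (suc (suc i)) = maxGapUpTo σ (tau σ φ (suc (suc i))) (tau σ φ (suc (suc i)))

prod0 : (ℕ → ℕ) → ℕ → ℕ
prod0 f zero    = f zero
prod0 f (suc r) = prod0 f r * f (suc r)

prod1 : (ℕ → ℕ) → ℕ → ℕ
prod1 f zero    = 1
prod1 f (suc r) = prod1 f r * f (suc r)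

-- ∏_{k'=0, k'≠k}^{r} f k'   ( = L / f k where L = prod0 f r )
coprod : (ℕ → ℕ) → ℕ → ℕ → ℕ
coprod f r k = prod0 (λ k' → g k') r
  where
  g : ℕ → ℕ
  g k' with k' Data.Nat.≟ k
  ... | yes _ = 1
  ... | no  _ = f k'

{-# OPTIONS --safe #-}
module Submission where

-- Fix a nonempty X. If every nonempty Z ⊆ X had an independent J with |X| |J| > α(X) |N_Z[J]|, then
-- peeling off the sets N_Z[J] would produce an independent set larger than α(X). So some Z expands,
-- and breadth-first layers in Z grow geometrically unless some layer of depth < τ_r / 2 has large
-- independence ratio; this gives ι(G) ≤ 3 n^(2/τ_r) max ι(layer).
--
-- Let W be a connected subset of a layer. The lowest common ancestor of W in the breadth-first tree,
-- at height d, splits W into two sides, and vertices of different sides are joined by a path of length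
-- 2d through earlier layers. Hence a path which starts on one side and then has M further vertices,
-- all on the other side, closes up to cycles of all lengths 2d + 1, ..., 2d + M. As consecutive
-- terms of σ up to τ_r differ by at most △_r, for M = σ_1 △_r one of these lengths is forbidden. Without
-- such a path the stack of a depth-first search stays shorter than M, so the search finds a set R with
-- |R| ≤ M and |N[R]| ≤ 2|R|; therefore ι(layer) ≤ 4 max {ι(R) : |R| ≤ M}, and ι(R) is bounded by
-- induction on r.
--
-- Adjacency may be assumed decidable because the conclusion is a stable proposition.

open import Defs
open import Data.Bool using (Bool; true; false)
open import Data.Bool.Properties as Bool using ()
import Data.Empty
open import Data.Empty using (⊥-elim)
open import Data.Fin using (Fin; zero; suc; inject₁; fromℕ)
open import Data.Fin.Properties using (_≟_; any?; all?)
open import Data.Fin.Subset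
  using (Subset; inside; outside; _∈_; _∉_; _⊆_; _∪_; _─_; ⊥; ⁅_⁆; ∣_∣; Nonempty)
open import Data.Fin.Subset.Properties
open import Data.List using (List; []; _∷_; _++_; length; lookup)
open import Data.List.Membership.Propositional using () renaming (_∈_ to _∈ˡ_; _∉_ to _∉ˡ_)
open import Data.List.Membership.Propositional.Properties using (∈-lookup; ∈-++⁻)
open import Data.List.Properties using (length-++)
open import Data.List.Relation.Unary.All as All using (All; []; _∷_)
import Data.List.Relation.Unary.All.Properties as All
open import Data.List.Relation.Unary.AllPairs using ([]; _∷_)
open import Data.List.Relation.Unary.Any using (here; there)
open import Data.List.Relation.Unary.Unique.Propositional using (Unique)
import Data.List.Relation.Unary.Unique.Propositional.Properties as Unique
open import Data.Nat
  using (ℕ; zero; suc; _+_; _*_; _∸_; _^_; _≤_; _<_; _≥_; _≰_; _≤ᵇ_; z≤n; s≤s; s≤s⁻¹;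
         ⌈_/2⌉; NonZero; >-nonZero)
open import Data.Nat.Induction using (<-wellFounded)
open import Data.Nat.Properties hiding (_≟_)
import Data.Nat.Properties as ℕ
open import Data.Nat.Tactic.RingSolver using (solve-∀)
open import Data.Product using (∃; ∃₂; _×_; _,_; proj₁; proj₂)
open import Data.Sum using (_⊎_; inj₁; inj₂; [_,_]′)
open import Data.Vec using (_∷_; []; tabulate; here; there)
open import Data.Vec.Properties using (lookup⇒[]=; []=⇒lookup; lookup∘tabulate)
open import Function using (_∘_; id; case_of_)
open import Induction.WellFounded using (Acc; acc)
open import Relation.Nullary using (¬_; Dec; yes; no; does; contradiction; _×-dec_; _→-dec_; ¬?)
open import Relation.Nullary.Decidable using (decidable-stable; ¬¬-excluded-middle; dec-true; dec-false; map′)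
open import Relation.Binary.PropositionalEquality
  using (_≡_; _≢_; refl; trans; cong; cong₂; subst; subst₂) renaming (sym to ≡-sym)
open import Relation.Unary using (Decidable)

-- Finite subsets: filters, cardinalities, maximal elements

module _ {n : ℕ} where

  [_∣_] : {P : Fin n → Set} → Subset n → Decidable P → Subset n
  [ X ∣ P? ] = tabulate λ x → does ((x ∈? X) ×-dec P? x)

  module _ {P : Fin n → Set} (X : Subset n) (P? : Decidable P) where

    ∈-filter⁺ : ∀ {x} → x ∈ X → P x → x ∈ [ X ∣ P? ]
    ∈-filter⁺ {x} x∈X px = lookup⇒[]= x _
      (trans (lookup∘tabulate _ x) (dec-true ((x ∈? X) ×-dec P? x) (x∈X , px)))

    ∈-filter⁻ : ∀ {x} → x ∈ [ X ∣ P? ] → x ∈ X × P x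
    ∈-filter⁻ {x} x∈ with x ∈? X | P? x | trans (≡-sym (lookup∘tabulate _ x)) ([]=⇒lookup x∈)
    ... | yes x∈X | yes px | _  = x∈X , px
    ... | yes _   | no _   | ()
    ... | no _    | _      | ()

    filter⊆ : [ X ∣ P? ] ⊆ X
    filter⊆ = proj₁ ∘ ∈-filter⁻

∣p∪q∣≤∣p∣+∣q∣ : ∀ {n} (p q : Subset n) → ∣ p ∪ q ∣ ≤ ∣ p ∣ + ∣ q ∣
∣p∪q∣≤∣p∣+∣q∣ [] [] = z≤n
∣p∪q∣≤∣p∣+∣q∣ (inside ∷ p) (inside ∷ q) =
  s≤s (≤-trans (∣p∪q∣≤∣p∣+∣q∣ p q) (+-monoʳ-≤ ∣ p ∣ (n≤1+n ∣ q ∣)))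
∣p∪q∣≤∣p∣+∣q∣ (inside ∷ p) (outside ∷ q) = s≤s (∣p∪q∣≤∣p∣+∣q∣ p q)
∣p∪q∣≤∣p∣+∣q∣ (outside ∷ p) (inside ∷ q) =
  ≤-trans (s≤s (∣p∪q∣≤∣p∣+∣q∣ p q)) (≤-reflexive (≡-sym (+-suc ∣ p ∣ ∣ q ∣)))
∣p∪q∣≤∣p∣+∣q∣ (outside ∷ p) (outside ∷ q) = ∣p∪q∣≤∣p∣+∣q∣ p q

disjoint⇒∣p∣+∣q∣≤∣p∪q∣ : ∀ {n} (p q : Subset n) → (∀ {x} → x ∈ p → x ∉ q) →
                          ∣ p ∣ + ∣ q ∣ ≤ ∣ p ∪ q ∣
disjoint⇒∣p∣+∣q∣≤∣p∪q∣ [] [] _ = z≤n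
disjoint⇒∣p∣+∣q∣≤∣p∪q∣ (inside ∷ p) (inside ∷ q) p#q = ⊥-elim (p#q here here)
disjoint⇒∣p∣+∣q∣≤∣p∪q∣ (inside ∷ p) (outside ∷ q) p#q =
  s≤s (disjoint⇒∣p∣+∣q∣≤∣p∪q∣ p q λ x∈p x∈q → p#q (there x∈p) (there x∈q))
disjoint⇒∣p∣+∣q∣≤∣p∪q∣ (outside ∷ p) (inside ∷ q) p#q =
  ≤-trans (≤-reflexive (+-suc ∣ p ∣ ∣ q ∣))
    (s≤s (disjoint⇒∣p∣+∣q∣≤∣p∪q∣ p q λ x∈p x∈q → p#q (there x∈p) (there x∈q)))
disjoint⇒∣p∣+∣q∣≤∣p∪q∣ (outside ∷ p) (outside ∷ q) p#q =
  disjoint⇒∣p∣+∣q∣≤∣p∪q∣ p q λ x∈p x∈q → p#q (there x∈p) (there x∈q)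

∈─⇒∉ : ∀ {n} (p q : Subset n) {x} → x ∈ p ─ q → x ∉ q
∈─⇒∉ (_ ∷ p) (inside ∷ q) (there x∈) (there x∈q) = ∈─⇒∉ p q x∈ x∈q
∈─⇒∉ (_ ∷ p) (outside ∷ q) (there x∈) (there x∈q) = ∈─⇒∉ p q x∈ x∈q

∣p∣≤∣q∣+∣p─q∣ : ∀ {n} (p q : Subset n) → ∣ p ∣ ≤ ∣ q ∣ + ∣ p ─ q ∣
∣p∣≤∣q∣+∣p─q∣ p q = ≤-trans (p⊆q⇒∣p∣≤∣q∣ cover) (∣p∪q∣≤∣p∣+∣q∣ q (p ─ q))
  where
  cover : p ⊆ q ∪ (p ─ q)
  cover {x} x∈p with x ∈? q
  ... | yes x∈q = x∈p∪q⁺ (inj₁ x∈q)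
  ... | no x∉q  = x∈p∪q⁺ (inj₂ (x∈p∧x∉q⇒x∈p─q x∈p x∉q))

x∈p⇒1≤∣p∣ : ∀ {n} {x : Fin n} {p} → x ∈ p → 1 ≤ ∣ p ∣
x∈p⇒1≤∣p∣ {x = x} {p} x∈p = subst (_≤ ∣ p ∣) (∣⁅x⁆∣≡1 x) (p⊆q⇒∣p∣≤∣q∣ λ y∈ →
  subst (_∈ p) (≡-sym (x∈⁅y⁆⇒x≡y x y∈)) x∈p)

1≤∣p∣⇒Nonempty : ∀ {n} {p : Subset n} → 1 ≤ ∣ p ∣ → Nonempty p
1≤∣p∣⇒Nonempty {n} {p} 1≤ with nonempty? p
... | yes ne = ne
... | no e   = contradiction (subst (λ q → 1 ≤ ∣ q ∣) (Empty-unique e) 1≤)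
                 (subst (_≰_ 1) (≡-sym (∣⊥∣≡0 n)) λ ())

fromList : ∀ {n} → List (Fin n) → Subset n
fromList []       = ⊥
fromList (x ∷ xs) = ⁅ x ⁆ ∪ fromList xs

∈-fromList⁺ : ∀ {n} {x : Fin n} {xs} → x ∈ˡ xs → x ∈ fromList xs
∈-fromList⁺ (here refl) = x∈p∪q⁺ (inj₁ (x∈⁅x⁆ _))
∈-fromList⁺ (there x∈)  = x∈p∪q⁺ (inj₂ (∈-fromList⁺ x∈))

∣fromList∣≤length : ∀ {n} (xs : List (Fin n)) → ∣ fromList xs ∣ ≤ length xs
∣fromList∣≤length {n} []       = ≤-reflexive (∣⊥∣≡0 n)
∣fromList∣≤length (x ∷ xs) = ≤-trans (∣p∪q∣≤∣p∣+∣q∣ ⁅ x ⁆ (fromList xs))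
  (+-mono-≤ (≤-reflexive (∣⁅x⁆∣≡1 x)) (∣fromList∣≤length xs))

-- Recursion on the first membership bit, comparing the best sets of the two halves. The order laws
-- are only required within `P`: comparing ratios by cross-multiplication is transitive only between
-- sets whose denominators are positive.
maximal : ∀ {n} {P : Subset n → Set} {_≼_ : Subset n → Subset n → Set} → Decidable P →
  (∀ {p} → P p → p ≼ p) → (∀ {p q} → P p → P q → p ≼ q ⊎ q ≼ p) →
  (∀ {p q r} → P p → P q → P r → p ≼ q → q ≼ r → p ≼ r) →
  ∃ P → ∃ λ m → P m × (∀ {p} → P p → p ≼ m)
maximal {zero} P? ≼-refl _ _ ([] , p[]) = [] , p[] , λ { {[]} _ → ≼-refl p[] }
maximal {suc n} {P} {_≼_} P? ≼-refl ≼-total ≼-trans (q , pq) = result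
  where
  half : ∀ s → (∃ λ p → P (s ∷ p)) → ∃ λ m → P (s ∷ m) × (∀ {p} → P (s ∷ p) → (s ∷ p) ≼ (s ∷ m))
  half s = maximal {n} {P ∘ (s ∷_)} {λ p q → (s ∷ p) ≼ (s ∷ q)} (P? ∘ (s ∷_)) ≼-refl ≼-total ≼-trans

  result : ∃ λ m → P m × (∀ {p} → P p → p ≼ m)
  result with anySubset? (P? ∘ (inside ∷_)) | anySubset? (P? ∘ (outside ∷_))
  ... | no ¬i | no ¬o = ⊥-elim (absurd q pq)
    where
    absurd : ∀ q → ¬ P q
    absurd (inside ∷ p)  pp = ¬i (p , pp)
    absurd (outside ∷ p) pp = ¬o (p , pp)
  ... | yes i | no ¬o = let m , pm , max = half inside i in inside ∷ m , pm , λ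
    { {inside ∷ p} → max ; {outside ∷ p} pp → contradiction (p , pp) ¬o }
  ... | no ¬i | yes o = let m , pm , max = half outside o in outside ∷ m , pm , λ
    { {outside ∷ p} → max ; {inside ∷ p} pp → contradiction (p , pp) ¬i }
  ... | yes i | yes o with half inside i | half outside o
  ... | mi , pi , maxi | mo , po , maxo with ≼-total pi po
  ... | inj₁ i≼o = outside ∷ mo , po , λ
    { {outside ∷ p} → maxo ; {inside ∷ p} pp → ≼-trans pp pi po (maxi pp) i≼o }
  ... | inj₂ o≼i = inside ∷ mi , pi , λ
    { {inside ∷ p} → maxi ; {outside ∷ p} pp → ≼-trans pp po pi (maxo pp) o≼i }

-- Finiteness lets double negation pass through the quantifier. Applied twice, it supplies decidable
-- adjacency under a double negation.
¬¬-∀ : ∀ {n} {P : Fin n → Set} → (∀ i → ¬ ¬ P i) → ¬ ¬ (∀ i → P i)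
¬¬-∀ {zero}  f k = k λ ()
¬¬-∀ {suc n} f k = f zero λ p₀ → ¬¬-∀ (f ∘ suc) λ ps → k λ { zero → p₀ ; (suc i) → ps i }

-- Paths and cycles

module _ {n : ℕ} (G : Graph n) where

  -- The list holds the inner vertices only: a path has one edge more than its list has entries, and
  -- a closed walk is a path with equal ends.
  data Path : Fin n → List (Fin n) → Fin n → Set where
    edge : ∀ {u v} → Adj G u v → Path u [] v
    step : ∀ {u x xs v} → Adj G u x → Path x xs v → Path u (x ∷ xs) v

  path-snoc : ∀ {u xs v w} → Path u xs v → Adj G v w → Path u (xs ++ v ∷ []) w
  path-snoc (edge e)   e′ = step e (edge e′)
  path-snoc (step e p) e′ = step e (path-snoc p e′)

  path-adj : ∀ {u xs v} → Path u xs v → (i : Fin (length xs)) →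
             Adj G (lookup (u ∷ xs) (inject₁ i)) (lookup (u ∷ xs) (suc i))
  path-adj (step e p) zero    = e
  path-adj (step e p) (suc i) = path-adj p i

  path-last : ∀ {u xs v} → Path u xs v → Adj G (lookup (u ∷ xs) (fromℕ (length xs))) v
  path-last (edge e)   = e
  path-last (step e p) = path-last p

  lookup-injective : ∀ {xs : List (Fin n)} → Unique xs → ∀ {i j} → lookup xs i ≡ lookup xs j → i ≡ j
  lookup-injective (x∉ ∷ u) {zero}  {zero}  _  = refl
  lookup-injective (x∉ ∷ u) {zero}  {suc j} eq = contradiction eq (All.lookup x∉ (∈-lookup j))
  lookup-injective (x∉ ∷ u) {suc i} {zero}  eq = contradiction (≡-sym eq) (All.lookup x∉ (∈-lookup i))
  lookup-injective (x∉ ∷ u) {suc i} {suc j} eq = cong suc (lookup-injective u eq)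

  closedPath⇒cycle : ∀ {v xs} → Path v xs v → Unique (v ∷ xs) → HasCycle G (suc (length xs))
  closedPath⇒cycle {v} {xs} p u = lookup (v ∷ xs) , lookup-injective u , path-adj p , path-last p

  -- Assembling independent sets by peeling

  NbrsIn : Subset n → Subset n → Subset n → Set
  NbrsIn Z J N = ∀ {x z} → x ∈ J → z ∈ Z → Adj G x z → z ∈ N

  -- `N` stands for the closed neighbourhood of `J` in `Z`, but may be larger. The bound is ∣N∣/∣J∣
  -- ≤ k/t without division.
  record Piece (t k : ℕ) (Z : Subset n) : Set where
    field
      {J N}    : Subset n
      J⊆N      : J ⊆ N
      N⊆Z      : N ⊆ Z
      nonempty : Nonempty N
      indep    : Independent G Z J
      nbrs     : NbrsIn Z J N
      bound    : ∣ N ∣ * t ≤ k * ∣ J ∣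

  -- Take a piece, delete its `N`, and repeat. What remains has no neighbour in `J`, so the union of
  -- all the `J` is independent, and the bounds of the pieces add up because the deleted sets cover
  -- `Y`.
  peel : ∀ t k Y → (∀ Z → Z ⊆ Y → Nonempty Z → Piece t k Z) →
         ∃ λ J → Independent G Y J × ∣ Y ∣ * t ≤ k * ∣ J ∣
  peel t k Y = go Y (<-wellFounded ∣ Y ∣)
    where
    go : ∀ Y → Acc _<_ ∣ Y ∣ → (∀ Z → Z ⊆ Y → Nonempty Z → Piece t k Z) →
         ∃ λ J → Independent G Y J × ∣ Y ∣ * t ≤ k * ∣ J ∣
    go Y (acc rs) pieces with nonempty? Y
    ... | no empty = ⊥ , (⊥⊆ , λ u∈ → contradiction u∈ ∉⊥) ,
                     subst (λ Z → ∣ Z ∣ * t ≤ k * ∣ ⊥ {n} ∣) (≡-sym (Empty-unique empty))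
                       (subst (λ m → m * t ≤ k * m) (≡-sym (∣⊥∣≡0 n)) z≤n)
    ... | yes ne = J ∪ J′ , (J∪J′⊆Y , independent) , total
      where
      open Piece (pieces Y ⊆-refl ne)
      rest = go (Y ─ N)
        (rs (p∩q≢∅⇒∣p─q∣<∣p∣ Y N (proj₁ nonempty , x∈p∩q⁺ (N⊆Z (proj₂ nonempty) , proj₂ nonempty))))
        (λ Z Z⊆ → pieces Z (⊆-trans Z⊆ (p─q⊆p Y N)))
      J′ = proj₁ rest
      indep′ = proj₁ (proj₂ rest)

      J∪J′⊆Y : J ∪ J′ ⊆ Y
      J∪J′⊆Y x∈ = [ proj₁ indep , p─q⊆p Y N ∘ proj₁ indep′ ]′ (x∈p∪q⁻ J J′ x∈)

      J′∉N : ∀ {x} → x ∈ J′ → x ∉ N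
      J′∉N = ∈─⇒∉ Y N ∘ proj₁ indep′

      independent : ∀ {u v} → u ∈ J ∪ J′ → v ∈ J ∪ J′ → ¬ Adj G u v
      independent u∈ v∈ e with x∈p∪q⁻ J J′ u∈ | x∈p∪q⁻ J J′ v∈
      ... | inj₁ u∈J  | inj₁ v∈J  = proj₂ indep u∈J v∈J e
      ... | inj₁ u∈J  | inj₂ v∈J′ = J′∉N v∈J′ (nbrs u∈J (J∪J′⊆Y v∈) e)
      ... | inj₂ u∈J′ | inj₁ v∈J  = J′∉N u∈J′ (nbrs v∈J (J∪J′⊆Y u∈) (sym G e))
      ... | inj₂ u∈J′ | inj₂ v∈J′ = proj₂ indep′ u∈J′ v∈J′ e

      open ≤-Reasoning
      total : ∣ Y ∣ * t ≤ k * ∣ J ∪ J′ ∣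
      total = begin
        ∣ Y ∣ * t                     ≤⟨ *-monoˡ-≤ t (∣p∣≤∣q∣+∣p─q∣ Y N) ⟩
        (∣ N ∣ + ∣ Y ─ N ∣) * t       ≡⟨ *-distribʳ-+ t ∣ N ∣ ∣ Y ─ N ∣ ⟩
        ∣ N ∣ * t + ∣ Y ─ N ∣ * t     ≤⟨ +-mono-≤ bound (proj₂ (proj₂ rest)) ⟩
        k * ∣ J ∣ + k * ∣ J′ ∣        ≡⟨ *-distribˡ-+ k ∣ J ∣ ∣ J′ ∣ ⟨
        k * (∣ J ∣ + ∣ J′ ∣)          ≤⟨ *-monoʳ-≤ k
                                          (disjoint⇒∣p∣+∣q∣≤∣p∪q∣ J J′ λ x∈J x∈J′ → J′∉N x∈J′ (J⊆N x∈J)) ⟩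
        k * ∣ J ∪ J′ ∣                ∎

  -- Connectivity in its cut form: this is exactly what a search consumes when it extends the set
  -- reached so far.
  Connected : Subset n → Set
  Connected X = ∀ W → W ⊆ X → Nonempty W → (∃ λ y → y ∈ X × y ∉ W) →
                ∃₂ λ x y → x ∈ W × y ∈ X × y ∉ W × Adj G x y

  -- Paths that start on one side and continue on the other

  module _ {X : Subset n} (c : Fin n → Bool) (b : Bool) where

    -- The index is the newest vertex and the list runs back to the root. Only the root is off
    -- colour `b`, so the length of the list counts both the edges and the vertices of colour `b`.
    data Trail : Fin n → List (Fin n) → Set where
      root : ∀ {w} → w ∈ X → c w ≢ b → Trail w []
      grow : ∀ {v u us} → Adj G v u → v ∈ X → c v ≡ b → v ∉ˡ u ∷ us → Trail u us → Trail v (u ∷ us)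

    trail-⊆ : ∀ {v us} → Trail v us → All (_∈ X) (v ∷ us)
    trail-⊆ (root w∈X _)         = w∈X ∷ []
    trail-⊆ (grow _ v∈X _ _ tr)  = v∈X ∷ trail-⊆ tr

    trail-unique : ∀ {v us} → Trail v us → Unique (v ∷ us)
    trail-unique (root _ _)          = [] ∷ []
    trail-unique (grow _ _ _ v∉ tr)  = All.¬Any⇒All¬ _ v∉ ∷ trail-unique tr

    -- The trail is read backwards from its newest vertex. The continuation form treats the
    -- one-vertex trail uniformly: there the root is the index and not an entry of the list.
    trail-root : ∀ {v us} → Trail v us →
                 ∃ λ w → w ∈ X × c w ≢ b × (∀ {xs z} → Path w xs z → Path v (us ++ xs) z)
    trail-root (root w∈X cw≢b) = _ , w∈X , cw≢b , id
    trail-root (grow e _ _ _ tr) =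
      let w , w∈X , cw≢b , extend = trail-root tr in w , w∈X , cw≢b , step e ∘ extend

    -- Vertices are dropped at the growing end, so the root survives. One long trail thus yields
    -- trails of all smaller lengths, hence a whole interval of cycle lengths.
    trail-cut : ∀ s {v us} → s ≤ length us → Trail v us →
                ∃₂ λ v′ us′ → Trail v′ us′ × length us′ ≡ s
    trail-cut s {us = us} s≤ tr with ℕ._≟_ s (length us)
    ... | yes eq = _ , _ , tr , ≡-sym eq
    trail-cut zero    s≤ (root _ _) | no ≢ = contradiction refl ≢
    trail-cut s       s≤ (grow _ _ _ _ tr) | no ≢ = trail-cut s (s≤s⁻¹ (≤∧≢⇒< s≤ ≢)) tr

  -- Components and depth-first search

  module _ (adj? : ∀ u v → Dec (Adj G u v)) where

    open import Data.List.Membership.DecPropositional (_≟_ {n}) using () renaming (_∈?_ to _∈ˡ?_)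

    -- Descend to a proper nonempty subset that is closed under adjacency as long as there is one.
    -- Once there is none, every cut is crossed by an edge; closedness composes along the descent.
    component : ∀ X → Nonempty X → ∃ λ Z → Z ⊆ X × Nonempty Z × NbrsIn X Z Z × Connected Z
    component X = go X (<-wellFounded ∣ X ∣)
      where
      go : ∀ X → Acc _<_ ∣ X ∣ → Nonempty X →
           ∃ λ Z → Z ⊆ X × Nonempty Z × NbrsIn X Z Z × Connected Z
      go X (acc rs) ne = result
        where
        Proper : Subset n → Set
        Proper W = W ⊆ X × Nonempty W × (∃ λ y → y ∈ X × y ∉ W)

        Closed : Subset n → Set
        Closed W = ∀ x z → x ∈ W → z ∈ X → Adj G x z → z ∈ W

        closed? : Decidable Closed
        closed? W = all? λ x → all? λ z → (x ∈? W) →-dec ((z ∈? X) →-dec (adj? x z →-dec (z ∈? W)))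

        proper? : Decidable Proper
        proper? W = (W ⊆? X) ×-dec (nonempty? W ×-dec any? λ y → (y ∈? X) ×-dec ¬? (y ∈? W))

        result : ∃ λ Z → Z ⊆ X × Nonempty Z × NbrsIn X Z Z × Connected Z
        result with anySubset? (λ W → proper? W ×-dec closed? W)
        ... | yes (W , (W⊆X , W≠∅ , y , y∈X , y∉W) , closed) =
          let Z , Z⊆W , Z≠∅ , Zclosed , connected = go W (rs (p⊂q⇒∣p∣<∣q∣ (W⊆X , y , y∈X , y∉W))) W≠∅
          in Z , ⊆-trans Z⊆W W⊆X , Z≠∅ ,
             (λ x∈Z z∈X e → Zclosed x∈Z (closed _ _ (Z⊆W x∈Z) z∈X e) e) , connected
        ... | no none = X , ⊆-refl , ne , (λ _ z∈X _ → z∈X) , connected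
          where
          connected : Connected X
          connected W W⊆X W≠∅ rest with any? (λ x → any? λ y →
            (x ∈? W) ×-dec ((y ∈? X) ×-dec (¬? (y ∈? W) ×-dec adj? x y)))
          ... | yes found = found
          ... | no ¬found = ⊥-elim (none (W , (W⊆X , W≠∅ , rest) , closed))
            where
            closed : Closed W
            closed x z x∈W z∈X e =
              decidable-stable (z ∈? W) λ z∉W → ¬found (x , z , x∈W , z∈X , z∉W , e)

    module _ {X : Subset n} (c : Fin n → Bool) (b : Bool)
             (Y : Subset n) (Y⊆X : Y ⊆ X) (Y≡b : ∀ {y} → y ∈ Y → c y ≡ b) where

      -- The depth-first search in `Y` needs a trail from the other side that ends next to `Y`
      -- without entering it. A set `W` disjoint from `Y`, each vertex of which ends a trail inside
      -- `W`, is enlarged along crossing edges until one of these hits `Y`.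
      approach : Connected X → Nonempty Y → ∃ (λ w → w ∈ X × c w ≢ b) →
                 ∃ λ y → ∃₂ λ u us → y ∈ Y × Adj G y u × Trail {X} c b u us × All (_∉ Y) (u ∷ us)
      -- `W₀` contains every vertex off colour `b`, so each vertex added later has colour `b` and
      -- may extend a trail.
      approach connected Y≠∅ (w , w∈X , cw≢b) = go n W₀ (m<m+n n (x∈p⇒1≤∣p∣ w∈W₀))
        (filter⊆ X other?) (λ v∈X cv≢b → ∈-filter⁺ X other? v∈X cv≢b)
        (λ v∈W₀ y∈Y → proj₂ (∈-filter⁻ X other? v∈W₀) (Y≡b y∈Y)) λ v∈W₀ →
          [] , root (filter⊆ X other? v∈W₀) (proj₂ (∈-filter⁻ X other? v∈W₀)) , v∈W₀ ∷ []
        where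
        other? : Decidable (λ v → c v ≢ b)
        other? v = ¬? (Bool._≟_ (c v) b)
        W₀ : Subset n
        W₀ = [ X ∣ other? ]
        w∈W₀ : w ∈ W₀
        w∈W₀ = ∈-filter⁺ X other? w∈X cw≢b
        go : ∀ fuel W → n < fuel + ∣ W ∣ → W ⊆ X → (∀ {v} → v ∈ X → c v ≢ b → v ∈ W) →
             (∀ {v} → v ∈ W → v ∉ Y) →
             (∀ {v} → v ∈ W → ∃ λ us → Trail {X} c b v us × All (_∈ W) (v ∷ us)) →
             ∃ λ y → ∃₂ λ u us → y ∈ Y × Adj G y u × Trail {X} c b u us × All (_∉ Y) (u ∷ us)
        go zero W n< = contradiction (∣p∣≤n W) (<⇒≱ n<)
        go (suc fuel) W n< W⊆X ≢b⊆W W∉Y trails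
          with connected W W⊆X (w , ≢b⊆W w∈X cw≢b)
                 (proj₁ Y≠∅ , Y⊆X (proj₂ Y≠∅) , λ y∈W → W∉Y y∈W (proj₂ Y≠∅))
        ... | u , v , u∈W , v∈X , v∉W , e with trails u∈W | v ∈? Y
        ... | us , tr , ⊆W | yes v∈Y = v , u , us , v∈Y , sym G e , tr , All.map W∉Y ⊆W
        ... | us , tr , ⊆W | no v∉Y = go fuel (W ∪ ⁅ v ⁆) grows
          (λ x∈ → [ W⊆X , (λ x∈v → subst (_∈ X) (≡-sym (x∈⁅y⁆⇒x≡y v x∈v)) v∈X) ]′ (x∈p∪q⁻ W ⁅ v ⁆ x∈))
          (λ x∈X cx≢b → W⊆ (≢b⊆W x∈X cx≢b))
          (λ x∈ → [ W∉Y , (λ x∈v → subst (_∉ Y) (≡-sym (x∈⁅y⁆⇒x≡y v x∈v)) v∉Y) ]′ (x∈p∪q⁻ W ⁅ v ⁆ x∈))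
          (λ x∈ → [ (λ x∈W → let xs , tr′ , ⊆W′ = trails x∈W in xs , tr′ , All.map W⊆ ⊆W′)
                  , (λ x∈v → subst (λ x → ∃ λ us → Trail {X} c b x us × All (_∈ W ∪ ⁅ v ⁆) (x ∷ us))
                      (≡-sym (x∈⁅y⁆⇒x≡y v x∈v)) (u ∷ us , grow (sym G e) v∈X cv≡b v∉ tr ,
                         q⊆p∪q W ⁅ v ⁆ (x∈⁅x⁆ v) ∷ All.map W⊆ ⊆W))
                  ]′ (x∈p∪q⁻ W ⁅ v ⁆ x∈))
          where
          W⊆ : W ⊆ W ∪ ⁅ v ⁆
          W⊆ = p⊆p∪q ⁅ v ⁆
          cv≡b : c v ≡ b
          cv≡b = decidable-stable (Bool._≟_ (c v) b) (v∉W ∘ ≢b⊆W v∈X)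
          v∉ : v ∉ˡ u ∷ us
          v∉ v∈ = v∉W (All.lookup ⊆W v∈)
          grows : n < fuel + ∣ W ∪ ⁅ v ⁆ ∣
          grows = <-≤-trans (subst (n <_) (≡-sym (+-suc fuel ∣ W ∣)) n<) (+-monoʳ-≤ fuel (begin
            suc ∣ W ∣            ≡⟨ +-comm 1 ∣ W ∣ ⟩
            ∣ W ∣ + 1            ≡⟨ cong (∣ W ∣ +_) (∣⁅x⁆∣≡1 v) ⟨
            ∣ W ∣ + ∣ ⁅ v ⁆ ∣    ≤⟨ disjoint⇒∣p∣+∣q∣≤∣p∪q∣ W ⁅ v ⁆
                                     (λ x∈W x∈v → v∉W (subst (_∈ W) (x∈⁅y⁆⇒x≡y v x∈v) x∈W)) ⟩
            ∣ W ∪ ⁅ v ⁆ ∣        ∎))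
            where open ≤-Reasoning

      LongTrail : ℕ → Set
      LongTrail M = ∃₂ λ v us → Trail {X} c b v us × M ≤ length us

      record SmallBoundary (M : ℕ) : Set where
        field
          {R N}    : Subset n
          nonempty : Nonempty R
          R⊆N      : R ⊆ N
          N⊆Y      : N ⊆ Y
          nbrs     : NbrsIn Y R N
          small    : ∣ R ∣ ≤ M
          double   : ∣ N ∣ ≤ 2 * ∣ R ∣

      -- Depth-first search in Y: S is the set of vertices already left, the list p ∷ ps is the stack.
      -- A vertex is left only when all its neighbours in Y have been visited, so N(S) ⊆ S ∪ stack.
      dfs : ∀ M {y u us} → y ∈ Y → Adj G y u → Trail {X} c b u us → All (_∉ Y) (u ∷ us) →
            LongTrail M ⊎ SmallBoundary M
      dfs zero y∈Y e tr _ = inj₁ (_ , _ , tr , z≤n)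
      -- A push or a pop raises 2∣S∣ plus the stack length by exactly one. Both ∣S∣ and the stack
      -- length stay below M, so fuel 3M never runs out.
      dfs (suc m) {y} {u} {us} y∈Y e tr outsideY = go (2 * M + M) ⊥ y [] (λ x∈ → contradiction x∈ ∉⊥)
        (y∈Y ∷ []) (∉⊥ ∷ []) (grow e (Y⊆X y∈Y) (Y≡b y∈Y) (λ y∈ → All.lookup outsideY y∈ y∈Y) tr)
        (λ x∈ → contradiction x∈ ∉⊥) (subst (_< M) (≡-sym (∣⊥∣≡0 n)) (s≤s z≤n))
        (≤-trans (m≤n+m _ 1) (m≤n+m _ (2 * ∣ ⊥ {n} ∣)))
        where
        M = suc m
        base = u ∷ us

        go : ∀ fuel S p ps → S ⊆ Y → All (_∈ Y) (p ∷ ps) → All (_∉ S) (p ∷ ps) →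
             Trail {X} c b p (ps ++ base) →
             (∀ {x z} → x ∈ S → z ∈ Y → Adj G x z → z ∈ S ⊎ z ∈ˡ p ∷ ps) → ∣ S ∣ < M →
             2 * M + M ≤ 2 * ∣ S ∣ + (length (p ∷ ps) + fuel) → LongTrail M ⊎ SmallBoundary M
        go fuel S p ps S⊆Y stack⊆Y stack∉S tr done S<M fuel≤ with M ≤? length (ps ++ base)
        ... | yes long = inj₁ (p , ps ++ base , tr , long)
        ... | no short = search fuel fuel≤
          where
          -- `base` has at least one entry, which makes up for counting `p`.
          stack<M : length (p ∷ ps) < M
          stack<M = <-≤-trans (s≤s (≤-trans (≤-reflexive (+-comm 1 (length ps)))
            (≤-trans (+-monoʳ-≤ (length ps) (s≤s z≤n)) (≤-reflexive (≡-sym (length-++ ps {base})))))) (≰⇒> short)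

          S′ = S ∪ ⁅ p ⁆

          S′⊆Y : S′ ⊆ Y
          S′⊆Y x∈ = [ S⊆Y , (λ x∈p → subst (_∈ Y) (≡-sym (x∈⁅y⁆⇒x≡y p x∈p)) (All.head stack⊆Y)) ]′
            (x∈p∪q⁻ S ⁅ p ⁆ x∈)

          S′≤M : ∣ S′ ∣ ≤ M
          S′≤M = ≤-trans (∣p∪q∣≤∣p∣+∣q∣ S ⁅ p ⁆)
            (≤-trans (≤-reflexive (trans (cong (∣ S ∣ +_) (∣⁅x⁆∣≡1 p)) (+-comm ∣ S ∣ 1))) S<M)

          S<S′ : ∣ S ∣ < ∣ S′ ∣
          S<S′ = ≤-trans (≤-reflexive (trans (+-comm 1 ∣ S ∣) (cong (∣ S ∣ +_) (≡-sym (∣⁅x⁆∣≡1 p)))))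
            (disjoint⇒∣p∣+∣q∣≤∣p∪q∣ S ⁅ p ⁆ λ x∈S x∈p →
              All.head stack∉S (subst (_∈ S) (x∈⁅y⁆⇒x≡y p x∈p) x∈S))

          p∈S′ : p ∈ S′
          p∈S′ = q⊆p∪q S ⁅ p ⁆ (x∈⁅x⁆ p)

          pop : ∀ fuel → 2 * M + M ≤ 2 * ∣ S ∣ + (length (p ∷ ps) + suc fuel) →
                (∀ {x z} → x ∈ S′ → z ∈ Y → Adj G x z → z ∈ S′ ⊎ z ∈ˡ ps) →
                LongTrail M ⊎ SmallBoundary M
          pop fuel fuel≤ done′ = next ps tr stack⊆Y (trail-unique c b tr) stack∉S stack<M done′ fuel≤
            where
            next : ∀ ps → Trail {X} c b p (ps ++ base) → All (_∈ Y) (p ∷ ps) → Unique (p ∷ ps ++ base) →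
                   All (_∉ S) (p ∷ ps) → length (p ∷ ps) < M →
                   (∀ {x z} → x ∈ S′ → z ∈ Y → Adj G x z → z ∈ S′ ⊎ z ∈ˡ ps) →
                   2 * M + M ≤ 2 * ∣ S ∣ + (length (p ∷ ps) + suc fuel) →
                   LongTrail M ⊎ SmallBoundary M
            -- The stack becomes empty, so S′ is closed in `Y` and is its own neighbourhood.
            next [] _ _ _ _ _ done′ _ = inj₂ record
              { R = S′ ; N = S′ ; nonempty = p , p∈S′ ; R⊆N = id ; N⊆Y = S′⊆Y
              ; nbrs = λ x∈ z∈Y e → [ id , (λ ()) ]′ (done′ x∈ z∈Y e)
              ; small = S′≤M ; double = m≤n*m ∣ S′ ∣ 2 }
            next (q ∷ qs) (grow _ _ _ _ tr′) (_ ∷ qs⊆Y) (p≢ ∷ _) (_ ∷ qs∉S) qs<M done′ fuel≤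
              with M ≤? ∣ S′ ∣
            -- S′ has just reached M vertices while the stack is shorter than M; all neighbours of
            -- S′ lie in S′ or on the stack, which gives the factor 2.
            ... | yes M≤S′ = inj₂ record
              { R = S′ ; N = S′ ∪ fromList (q ∷ qs) ; nonempty = p , p∈S′
              ; R⊆N = p⊆p∪q _
              ; N⊆Y = λ x∈ → [ S′⊆Y , fromList-⊆ qs⊆Y ]′ (x∈p∪q⁻ S′ _ x∈)
              ; nbrs = λ x∈ z∈Y e → x∈p∪q⁺ ([ inj₁ , inj₂ ∘ ∈-fromList⁺ ]′ (done′ x∈ z∈Y e))
              ; small = S′≤M
              ; double = ≤-trans (∣p∪q∣≤∣p∣+∣q∣ S′ _) (+-monoʳ-≤ ∣ S′ ∣ (≤-trans (∣fromList∣≤length (q ∷ qs))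
                  (≤-trans (<⇒≤ (<⇒≤ qs<M)) (≤-trans M≤S′ (m≤m+n ∣ S′ ∣ 0))))) }
              where
              fromList-⊆ : ∀ {xs} → All (_∈ Y) xs → fromList xs ⊆ Y
              fromList-⊆ []         x∈ = contradiction x∈ ∉⊥
              fromList-⊆ (h∈ ∷ all) x∈ = [ (λ x∈h → subst (_∈ Y) (≡-sym (x∈⁅y⁆⇒x≡y _ x∈h)) h∈)
                                         , fromList-⊆ all ]′ (x∈p∪q⁻ _ _ x∈)
            ... | no M≰S′ = go fuel S′ q qs S′⊆Y qs⊆Y
              (All.zipWith (λ { (x∉S , p≢x) x∈ → [ x∉S , (λ x∈p → p≢x (≡-sym (x∈⁅y⁆⇒x≡y p x∈p))) ]′
                                                   (x∈p∪q⁻ S ⁅ p ⁆ x∈) }) (qs∉S , All.++⁻ˡ (q ∷ qs) p≢))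
              tr′ done′ (≰⇒> M≰S′) (begin
                2 * M + M                                        ≤⟨ fuel≤ ⟩
                2 * ∣ S ∣ + (2 + (length qs + suc fuel))         ≡⟨ cong (λ k → 2 * ∣ S ∣ + (2 + k)) (+-suc (length qs) fuel) ⟩
                2 * ∣ S ∣ + (2 + suc (length qs + fuel))         ≡⟨ +-assoc (2 * ∣ S ∣) 2 _ ⟨
                (2 * ∣ S ∣ + 2) + suc (length qs + fuel)         ≡⟨ cong (_+ suc (length qs + fuel)) (trans (+-comm (2 * ∣ S ∣) 2) (≡-sym (*-suc 2 ∣ S ∣))) ⟩
                2 * suc ∣ S ∣ + suc (length qs + fuel)           ≤⟨ +-monoˡ-≤ _ (*-monoʳ-≤ 2 S<S′) ⟩
                2 * ∣ S′ ∣ + suc (length qs + fuel)              ∎)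
              where open ≤-Reasoning

          search : ∀ fuel → 2 * M + M ≤ 2 * ∣ S ∣ + (length (p ∷ ps) + fuel) → LongTrail M ⊎ SmallBoundary M
          search zero fuel≤ = contradiction fuel≤ (<⇒≱ (+-mono-≤-<
            (*-monoʳ-≤ 2 (<⇒≤ S<M)) (subst (_< M) (≡-sym (+-identityʳ _)) stack<M)))
          search (suc fuel) fuel≤
            with any? (λ z → (z ∈? Y) ×-dec (adj? p z ×-dec (¬? (z ∈? S) ×-dec ¬? (z ∈ˡ? p ∷ ps))))
          ... | yes (z , z∈Y , e , z∉S , z∉stack) =
            go fuel S z (p ∷ ps) S⊆Y (z∈Y ∷ stack⊆Y) (z∉S ∷ stack∉S)
              (grow (sym G e) (Y⊆X z∈Y) (Y≡b z∈Y)
                (λ z∈ → [ z∉stack , (λ z∈base → All.lookup outsideY z∈base z∈Y) ]′ (∈-++⁻ (p ∷ ps) z∈)) tr)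
              (λ x∈S w∈Y e → [ inj₁ , inj₂ ∘ there ]′ (done x∈S w∈Y e)) S<M
              (subst (λ k → 2 * M + M ≤ 2 * ∣ S ∣ + suc k) (+-suc (length ps) fuel) fuel≤)
          ... | no none = pop fuel fuel≤ λ {x} {z} x∈ z∈Y e → case x∈p∪q⁻ S ⁅ p ⁆ x∈ of λ
            { (inj₁ x∈S) → case done x∈S z∈Y e of λ
                { (inj₁ z∈S)         → inj₁ (p⊆p∪q _ z∈S)
                ; (inj₂ (here refl)) → inj₁ p∈S′
                ; (inj₂ (there z∈))  → inj₂ z∈ }
            ; (inj₂ x∈p) → visited z z∈Y (subst (λ x → Adj G x z) (x∈⁅y⁆⇒x≡y p x∈p) e) }
            where
            visited : ∀ z → z ∈ Y → Adj G p z → z ∈ S′ ⊎ z ∈ˡ ps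
            visited z z∈Y e with z ∈? S | z ∈ˡ? p ∷ ps
            ... | yes z∈S | _                = inj₁ (p⊆p∪q _ z∈S)
            ... | no _    | yes (here refl)  = inj₁ p∈S′
            ... | no _    | yes (there z∈)   = inj₂ z∈
            ... | no z∉S  | no z∉stack       = contradiction (z , z∈Y , e , z∉S , z∉stack) none

-- Geometric growth of layers

i<⌈τ/2⌉⇒i+i<τ : ∀ {i τ} → i < ⌈ τ /2⌉ → i + i < τ
i<⌈τ/2⌉⇒i+i<τ {zero}  {suc τ}       _   = s≤s z≤n
i<⌈τ/2⌉⇒i+i<τ {suc i} {suc (suc τ)} i<  =
  subst (_< 2 + τ) (cong suc (≡-sym (+-suc i i))) (s≤s (s≤s (i<⌈τ/2⌉⇒i+i<τ (s≤s⁻¹ i<))))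
i<⌈τ/2⌉⇒i+i<τ {suc i} {suc zero} (s≤s ())

τ≤⌈τ/2⌉+⌈τ/2⌉ : ∀ τ → τ ≤ ⌈ τ /2⌉ + ⌈ τ /2⌉
τ≤⌈τ/2⌉+⌈τ/2⌉ τ = subst (_≤ ⌈ τ /2⌉ + ⌈ τ /2⌉) (⌊n/2⌋+⌈n/2⌉≡n τ) (+-monoˡ-≤ _ (⌊n/2⌋≤⌈n/2⌉ τ))

m*m≡m^2 : ∀ m → m * m ≡ m ^ 2
m*m≡m^2 m = cong (m *_) (≡-sym (*-identityʳ m))

-- For u > 3w the values a are nondecreasing over the range considered, so the recurrence multiplies
-- them by at least u/(3w) at each of ⌈τ/2⌉ steps. As they are at most m, squaring gives (u/3w)^τ ≤
-- m².
expansion : ∀ τ u w m (a : ℕ → ℕ) → a 0 ≡ 0 → 1 ≤ a 1 → (∀ i → a i ≤ m) →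
  (∀ i → i + i < τ → u * a (suc i) ≤ w * (a i + a (suc i) + a (2 + i))) →
  u ^ τ ≤ (3 * w) ^ τ * m ^ 2
expansion τ u w m a a₀ a₁ a≤m rec with u ≤? 3 * w
... | yes u≤3w = ≤-trans (^-monoˡ-≤ τ u≤3w)
                   (m≤m*n _ (m ^ 2) ⦃ >-nonZero (^-monoˡ-≤ 2 (≤-trans a₁ (a≤m 1))) ⦄)
-- Squaring the bound for ⌈τ/2⌉ steps overshoots the exponent τ by its parity `e`; the surplus is
-- absorbed by v ≤ u and cancelled.
... | no u≰3w = *-cancelʳ-≤ _ _ (u ^ e) (begin
  u ^ τ * u ^ e                      ≡⟨ ^-distribˡ-+-* u τ e ⟨
  u ^ (τ + e)                        ≡⟨ cong (u ^_) τ+e≡ ⟩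
  u ^ (k + k)                        ≡⟨ ^-distribˡ-+-* u k k ⟩
  u ^ k * u ^ k                      ≤⟨ *-mono-≤ u^k≤ u^k≤ ⟩
  (v ^ k * m) * (v ^ k * m)          ≡⟨ [m*n]*[o*p]≡[m*o]*[n*p] (v ^ k) m (v ^ k) m ⟩
  (v ^ k * v ^ k) * (m * m)          ≡⟨ cong₂ _*_ (≡-sym (^-distribˡ-+-* v k k)) (m*m≡m^2 m) ⟩
  v ^ (k + k) * m ^ 2                ≡⟨ cong (λ l → v ^ l * m ^ 2) τ+e≡ ⟨
  v ^ (τ + e) * m ^ 2                ≡⟨ cong (_* m ^ 2) (^-distribˡ-+-* v τ e) ⟩
  v ^ τ * v ^ e * m ^ 2              ≤⟨ *-monoˡ-≤ (m ^ 2) (*-monoʳ-≤ (v ^ τ) (^-monoˡ-≤ e (<⇒≤ v<u))) ⟩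
  v ^ τ * u ^ e * m ^ 2              ≡⟨ *-assoc (v ^ τ) (u ^ e) (m ^ 2) ⟩
  v ^ τ * (u ^ e * m ^ 2)            ≡⟨ cong (v ^ τ *_) (*-comm (u ^ e) (m ^ 2)) ⟩
  v ^ τ * (m ^ 2 * u ^ e)            ≡⟨ *-assoc (v ^ τ) (m ^ 2) (u ^ e) ⟨
  v ^ τ * m ^ 2 * u ^ e              ∎)
  where
  open ≤-Reasoning
  v k e : ℕ
  v = 3 * w
  k = ⌈ τ /2⌉
  e = k + k ∸ τ
  v<u : v < u
  v<u = ≰⇒> u≰3w
  τ+e≡ : τ + e ≡ k + k
  τ+e≡ = m+[n∸m]≡n (τ≤⌈τ/2⌉+⌈τ/2⌉ τ)
  instance
    u≢0 : NonZero u
    u≢0 = >-nonZero (≤-<-trans z≤n v<u)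
    u^e≢0 : NonZero (u ^ e)
    u^e≢0 = m^n≢0 u e

  triple : ∀ q → w * (q + q + q) ≡ v * q
  triple q = begin-equality
    w * (q + q + q)    ≡⟨ cong (w *_) (trans (+-assoc q q q) (cong (λ r → q + (q + r)) (≡-sym (+-identityʳ q)))) ⟩
    w * (3 * q)        ≡⟨ *-assoc w 3 q ⟨
    w * 3 * q          ≡⟨ cong (_* q) (*-comm w 3) ⟩
    v * q              ∎

  grows : ∀ j → j ≤ k → a j ≤ a (suc j) × 1 ≤ a (suc j) × u ^ j ≤ v ^ j * a (suc j)
  grows zero _ = subst (_≤ a 1) (≡-sym a₀) z≤n , a₁ , subst (1 ≤_) (≡-sym (+-identityʳ (a 1))) a₁
  grows (suc j) j<k with grows j (<⇒≤ j<k) | a (suc j) ≤? a (2 + j)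
  ... | aj≤ , 1≤a , u^j≤ | yes a≤ = a≤ , ≤-trans 1≤a a≤ , (begin
    u * u ^ j                        ≤⟨ *-monoʳ-≤ u u^j≤ ⟩
    u * (v ^ j * a (suc j))          ≡⟨ *-assoc u (v ^ j) (a (suc j)) ⟨
    u * v ^ j * a (suc j)            ≡⟨ cong (_* a (suc j)) (*-comm u (v ^ j)) ⟩
    v ^ j * u * a (suc j)            ≡⟨ *-assoc (v ^ j) u (a (suc j)) ⟩
    v ^ j * (u * a (suc j))          ≤⟨ *-monoʳ-≤ (v ^ j) (≤-trans (rec j (i<⌈τ/2⌉⇒i+i<τ j<k))
                                         (≤-trans (*-monoʳ-≤ w (+-monoˡ-≤ (a (2 + j)) (+-mono-≤ (≤-trans aj≤ a≤) a≤)))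
                                         (≤-reflexive (triple (a (2 + j)))))) ⟩
    v ^ j * (v * a (2 + j))          ≡⟨ *-assoc (v ^ j) v (a (2 + j)) ⟨
    v ^ j * v * a (2 + j)            ≡⟨ cong (_* a (2 + j)) (*-comm (v ^ j) v) ⟩
    v * v ^ j * a (2 + j)            ∎)
  -- A decrease would make the middle term the largest of the three, and the recurrence would force
  -- u ≤ 3w.
  ... | aj≤ , 1≤a , _ | no a≰ = contradiction (*-cancelʳ-≤ u v (a (suc j)) ⦃ >-nonZero 1≤a ⦄ (begin
    u * a (suc j)                             ≤⟨ rec j (i<⌈τ/2⌉⇒i+i<τ j<k) ⟩
    w * (a j + a (suc j) + a (2 + j))         ≤⟨ *-monoʳ-≤ w (+-mono-≤ (+-monoˡ-≤ (a (suc j)) aj≤) (≰⇒≥ a≰)) ⟩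
    w * (a (suc j) + a (suc j) + a (suc j))   ≡⟨ triple (a (suc j)) ⟩
    v * a (suc j)                             ∎)) u≰3w

  u^k≤ : u ^ k ≤ v ^ k * m
  u^k≤ = ≤-trans (proj₂ (proj₂ (grows k ≤-refl))) (*-monoʳ-≤ (v ^ k) (a≤m (suc k)))

-- Breadth-first layers and their tree

module _ {n : ℕ} (G : Graph n) (adj? : ∀ u v → Dec (Adj G u v)) where

  module _ (Z : Subset n) (v : Fin n) where

    -- The root is layer 1 and ball 0 is empty: layer (suc i) is the set at distance i from v.
    ball : ℕ → Subset n
    reached? : ∀ k → Decidable (λ z → ∃ λ x → x ∈ ball k × Adj G x z)

    ball zero          = ⊥
    ball (suc zero)    = ⁅ v ⁆
    ball (suc (suc k)) = ball (suc k) ∪ [ Z ∣ reached? (suc k) ]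

    reached? k z = any? λ x → (x ∈? ball k) ×-dec adj? x z

    layer : ℕ → Subset n
    layer zero    = ⊥
    layer (suc i) = ball (suc i) ─ ball i

    ball-step : ∀ i {x z} → x ∈ ball i → z ∈ Z → Adj G x z → z ∈ ball (suc i)
    ball-step zero    x∈ _ _ = contradiction x∈ ∉⊥
    ball-step (suc i) x∈ z∈Z e = x∈p∪q⁺ (inj₂ (∈-filter⁺ Z (reached? (suc i)) z∈Z (_ , x∈ , e)))

    ball⊆Z : v ∈ Z → ∀ i → ball i ⊆ Z
    ball⊆Z v∈Z zero          x∈ = contradiction x∈ ∉⊥
    ball⊆Z v∈Z (suc zero)    x∈ = subst (_∈ Z) (≡-sym (x∈⁅y⁆⇒x≡y v x∈)) v∈Z
    ball⊆Z v∈Z (suc (suc i)) x∈ =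
      [ ball⊆Z v∈Z (suc i) , filter⊆ Z (reached? (suc i)) ]′ (x∈p∪q⁻ (ball (suc i)) _ x∈)

    layer⊆Z : v ∈ Z → ∀ i → layer i ⊆ Z
    layer⊆Z v∈Z zero    x∈ = contradiction x∈ ∉⊥
    layer⊆Z v∈Z (suc i) x∈ = ball⊆Z v∈Z (suc i) (p─q⊆p (ball (suc i)) (ball i) x∈)

    layer#ball : ∀ i {x} → x ∈ layer (suc i) → x ∉ ball i
    layer#ball i = ∈─⇒∉ (ball (suc i)) (ball i)

    layer⊆ball : ∀ i → layer i ⊆ ball i
    layer⊆ball zero    x∈ = contradiction x∈ ∉⊥
    layer⊆ball (suc i) = p─q⊆p (ball (suc i)) (ball i)

    -- A neighbour two or more layers closer to the root would have put the vertex itself into an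
    -- earlier ball.
    layer-nbrs : ∀ i → NbrsIn G Z (layer (suc i)) (layer i ∪ layer (suc i) ∪ layer (2 + i))
    layer-nbrs i {x} {z} x∈ z∈Z e with z ∈? ball (suc i) | z ∈? ball i
    ... | no z∉ | _ = x∈p∪q⁺ (inj₂ (x∈p∪q⁺ (inj₂
                        (x∈p∧x∉q⇒x∈p─q (ball-step (suc i) (layer⊆ball (suc i) x∈) z∈Z e) z∉))))
    ... | yes z∈ | no z∉ = x∈p∪q⁺ (inj₂ (x∈p∪q⁺ (inj₁ (x∈p∧x∉q⇒x∈p─q z∈ z∉))))
    ... | yes _  | yes z∈ = x∈p∪q⁺ (inj₁ (lower i x∈ z∈))
      where
      lower : ∀ i → x ∈ layer (suc i) → z ∈ ball i → z ∈ layer i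
      lower zero    _  z∈ = z∈
      lower (suc j) x∈ z∈ = x∈p∧x∉q⇒x∈p─q z∈ λ z∈ball →
        layer#ball (suc j) x∈ (ball-step j z∈ball (layer⊆Z′ x∈) (sym G e))
        where
        layer⊆Z′ : ∀ {x} → x ∈ layer (2 + j) → x ∈ Z
        layer⊆Z′ x∈ = [ (λ x∈b → contradiction x∈b (layer#ball (suc j) x∈))
                      , filter⊆ Z (reached? (suc j)) ]′ (x∈p∪q⁻ (ball (suc j)) _ (layer⊆ball (2 + j) x∈))

    module _ (v∈Z : v ∈ Z) where

      parent : ∀ j u → u ∈ layer (2 + j) → ∃ λ w → w ∈ layer (suc j) × Adj G u w
      parent j u u∈ with x∈p∪q⁻ (ball (suc j)) _ (layer⊆ball (2 + j) u∈)
      ... | inj₁ u∈ball = contradiction u∈ball (layer#ball (suc j) u∈)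
      ... | inj₂ u∈new with ∈-filter⁻ Z (reached? (suc j)) u∈new
      ... | u∈Z , w , w∈ball , e = w , x∈p∧x∉q⇒x∈p─q w∈ball
              (λ w∈ → layer#ball (suc j) u∈ (ball-step j w∈ u∈Z e)) , sym G e

      -- Independent of any membership proof, so equal vertices have equal parents. The default off
      -- layer `2 + j` makes it a total map that can be composed.
      par : ℕ → Fin n → Fin n
      par j u with u ∈? layer (2 + j)
      ... | yes u∈ = proj₁ (parent j u u∈)
      ... | no _   = u

      par-spec : ∀ j {u} → u ∈ layer (2 + j) → par j u ∈ layer (suc j) × Adj G u (par j u)
      par-spec j {u} u∈ with u ∈? layer (2 + j)
      ... | yes u∈′ = proj₂ (parent j u u∈′)
      ... | no u∉   = contradiction u∈ u∉

      -- The path has 2d edges, and its inner vertices lie in strictly earlier layers than its ends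
      -- will, so it can meet a trail inside the layer only at those ends.
      Joined : ℕ → ℕ → Fin n → Fin n → Set
      Joined j d a b = a ≢ b × ∃ λ inner → Path G a inner b × Unique inner × All (_∈ ball j) inner ×
                         suc (length inner) ≡ d + d

      -- In the breadth-first tree d is the height of the lowest common ancestor of f(X) above
      -- f(X), and c singles out the elements sent below one of its children.
      split : ∀ j X (f : Fin n → Fin n) → (∀ {x} → x ∈ X → f x ∈ layer (suc j)) →
        ∀ {x y} → x ∈ X → y ∈ X → f x ≢ f y →
        ∃₂ λ d (c : Fin n → Bool) → 1 ≤ d × d ≤ j × ∃ (λ x → x ∈ X × c x ≡ true) ×
          ∃ (λ y → y ∈ X × c y ≡ false) × (∀ {a b} → a ∈ X → b ∈ X → c a ≢ c b → Joined j d (f a) (f b))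
      split zero X f f∈ x∈X y∈X fx≢fy =
        contradiction (trans (f≡v x∈X) (≡-sym (f≡v y∈X))) fx≢fy
        where
        f≡v : ∀ {x} → x ∈ X → f x ≡ v
        f≡v x∈X = x∈⁅y⁆⇒x≡y v (layer⊆ball 1 (f∈ x∈X))
      split (suc j) X f f∈ {x} {y} x∈X y∈X fx≢fy
        with any? (λ z → (z ∈? X) ×-dec ¬? (par j (f z) ≟ par j (f x)))
      -- All of f(X) has one common parent: it is the ancestor sought, and the child `f x` defines
      -- the colour.
      ... | no constant = 1 , c , s≤s z≤n , s≤s z≤n , (x , x∈X , dec-true (f x ≟ f x) refl) ,
            (y , y∈X , dec-false (f y ≟ f x) (fx≢fy ∘ ≡-sym)) , λ {a} {b} a∈X b∈X ca≢cb →
            ca≢cb ∘ cong (λ u → does (u ≟ f x)) , par j (f x) ∷ [] ,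
            step (subst (Adj G (f a)) (par≡ a∈X) (proj₂ (par-spec j (f∈ a∈X))))
              (edge (sym G (subst (Adj G (f b)) (par≡ b∈X) (proj₂ (par-spec j (f∈ b∈X)))))) ,
            [] ∷ [] , layer⊆ball (suc j) (proj₁ (par-spec j (f∈ x∈X))) ∷ [] , refl
        where
        c : Fin n → Bool
        c z = does (f z ≟ f x)
        par≡ : ∀ {z} → z ∈ X → par j (f z) ≡ par j (f x)
        par≡ {z} z∈X = decidable-stable (_ ≟ _) λ ≢ → constant (z , z∈X , ≢)
      -- Otherwise the ancestor lies above the parents. The colouring lives on `X` and is kept,
      -- while each joining path gains one edge at either end.
      ... | yes (z , z∈X , pz≢px)
        with split j X (par j ∘ f) (λ x∈ → proj₁ (par-spec j (f∈ x∈))) z∈X x∈X pz≢px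
      ... | d , c , 1≤d , d≤j , x₁ , x₀ , joined =
        suc d , c , s≤s z≤n , s≤s d≤j , x₁ , x₀ , λ a∈X b∈X ca≢cb → extend a∈X b∈X (joined a∈X b∈X ca≢cb)
        where
        extend : ∀ {a b} → a ∈ X → b ∈ X → Joined j d (par j (f a)) (par j (f b)) →
                 Joined (suc j) (suc d) (f a) (f b)
        extend {a} {b} a∈X b∈X (pa≢pb , inner , path , unique , inner∈ , len) =
          pa≢pb ∘ cong (par j) , pa ∷ (inner ++ pb ∷ []) ,
          step (proj₂ (par-spec j (f∈ a∈X))) (path-snoc G path (sym G (proj₂ (par-spec j (f∈ b∈X))))) ,
          All.++⁺ (All.map (λ z∈ pa≡z → layer#ball j pa∈ (subst (_∈ ball j) (≡-sym pa≡z) z∈)) inner∈) (pa≢pb ∷ []) ∷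
            Unique.++⁺ unique ([] ∷ []) (λ { (z∈ , here refl) → layer#ball j pb∈ (All.lookup inner∈ z∈) }) ,
          layer⊆ball (suc j) pa∈ ∷ All.++⁺ (All.map (ball-mono j) inner∈) (layer⊆ball (suc j) pb∈ ∷ []) ,
          cong suc (trans (cong suc (trans (length-++ inner) (+-comm (length inner) 1))) (trans (cong suc len) (≡-sym (+-suc d d))))
          where
          pa = par j (f a)
          pb = par j (f b)
          pa∈ : pa ∈ layer (suc j)
          pa∈ = proj₁ (par-spec j (f∈ a∈X))
          pb∈ : pb ∈ layer (suc j)
          pb∈ = proj₁ (par-spec j (f∈ b∈X))
          ball-mono : ∀ j → ball j ⊆ ball (suc j)
          ball-mono zero    x∈ = contradiction x∈ ∉⊥
          ball-mono (suc j) x∈ = p⊆p∪q _ x∈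

-- Independence ratio of layers and of arbitrary sets

module _ {n : ℕ} (G : Graph n) (adj? : ∀ u v → Dec (Adj G u v)) where

  -- The bound ∣X∣/α(X) ≤ s/t with an explicit witness.
  HallBound : ℕ → ℕ → Subset n → Set
  HallBound s t X = ∃ λ J → Independent G X J × ∣ X ∣ * t ≤ s * ∣ J ∣

  module _ (τ M s t : ℕ) (1≤M : 1 ≤ M) (small-bound : ∀ R → ∣ R ∣ ≤ M → HallBound s t R)
           (no-cycle : ∀ d → 1 ≤ d → d + d < τ → ∃ λ l → 1 ≤ l × l ≤ M × ¬ HasCycle G (l + (d + d)))
    where

    module _ (Z : Subset n) (v : Fin n) (v∈Z : v ∈ Z) where

      private
        L = layer G adj? Z v

      module _ (i d : ℕ) (2d<τ : d + d < τ) (1≤d : 1 ≤ d) (X : Subset n) (X⊆L : X ⊆ L (suc i)) (c : Fin n → Bool)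
               (joined : ∀ {a b} → a ∈ X → b ∈ X → c a ≢ c b → Joined G adj? Z v v∈Z i d a b) where

        -- Cut the trail to the length `l` for which l + 2d is forbidden. Its root and its newest
        -- vertex have different colours, so a path of 2d edges through earlier layers closes it to
        -- a cycle of that length.
        no-long-trail : ∀ b {u us} → Trail G {X} c b u us → M ≤ length us → Data.Empty.⊥
        no-long-trail b tr M≤ with no-cycle d 1≤d 2d<τ
        ... | l , 1≤l , l≤M , ¬cycle with trail-cut G c b l (≤-trans l≤M M≤) tr
        no-long-trail b _ _ | _ , () , _ | _ , _ , root _ _ , refl
        no-long-trail b _ _ | l , _ , _ , ¬cycle | v′ , us′ , tr@(grow _ v′∈X cv′≡b _ _) , refl
          with trail-root G c b tr
        ... | w , w∈X , cw≢b , extend with joined w∈X v′∈X (λ eq → cw≢b (trans eq cv′≡b))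
        ... | _ , inner , path , unique , inner∈ , len =
          ¬cycle (subst (HasCycle G) length≡ (closedPath⇒cycle G (extend path)
            (Unique.++⁺ (trail-unique G c b tr) unique λ { (z∈tr , z∈inner) →
              layer#ball G adj? Z v i (X⊆L (All.lookup (trail-⊆ G c b tr) z∈tr)) (All.lookup inner∈ z∈inner) })))
          where
          length≡ : suc (length (us′ ++ inner)) ≡ l + (d + d)
          length≡ = trans (cong suc (length-++ us′)) (trans (≡-sym (+-suc (length us′) (length inner))) (cong (length us′ +_) len))

        -- Every nonempty part of a side yields a piece: the depth-first search cannot produce a
        -- long trail, so it finds a small `R`. An independent set from `small-bound` serves for
        -- `R`, and the factor 2 is the ratio of ∣N∣ to ∣R∣.
        side-bound : Connected G X → ∀ b → ∃ (λ w → w ∈ X × c w ≢ b) →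
                     HallBound (2 * s) t [ X ∣ (λ x → Bool._≟_ (c x) b) ]
        side-bound connected b other = peel G t (2 * s) _ piece
          where
          side? : Decidable (λ x → c x ≡ b)
          side? x = Bool._≟_ (c x) b
          piece : ∀ Y → Y ⊆ [ X ∣ side? ] → Nonempty Y → Piece G t (2 * s) Y
          piece Y Y⊆ Y≠∅ with approach G adj? c b Y (filter⊆ X side? ∘ Y⊆) (proj₂ ∘ ∈-filter⁻ X side? ∘ Y⊆) connected Y≠∅ other
          ... | y , u , us , y∈Y , e , tr , avoid
            with dfs G adj? c b Y (filter⊆ X side? ∘ Y⊆) (proj₂ ∘ ∈-filter⁻ X side? ∘ Y⊆) M y∈Y e tr avoid
          ... | inj₁ (_ , _ , long , M≤) = ⊥-elim (no-long-trail b long M≤)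
          ... | inj₂ sb = piece′
            where
            open SmallBoundary sb
            open ≤-Reasoning
            piece′ : Piece G t (2 * s) Y
            piece′ with small-bound R small
            ... | J , (J⊆R , indep) , bound = record
              { J = J ; N = N ; J⊆N = R⊆N ∘ J⊆R ; N⊆Z = N⊆Y
              ; nonempty = proj₁ nonempty , R⊆N (proj₂ nonempty)
              ; indep = N⊆Y ∘ R⊆N ∘ J⊆R , indep
              ; nbrs = nbrs ∘ J⊆R
              ; bound = begin
                  ∣ N ∣ * t          ≤⟨ *-monoˡ-≤ t double ⟩
                  2 * ∣ R ∣ * t      ≡⟨ *-assoc 2 ∣ R ∣ t ⟩
                  2 * (∣ R ∣ * t)    ≤⟨ *-monoʳ-≤ 2 bound ⟩
                  2 * (s * ∣ J ∣)    ≡⟨ *-assoc 2 s ∣ J ∣ ⟨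
                  2 * s * ∣ J ∣      ∎ }

      larger-side : ∀ X (c : Fin n → Bool) →
                    ∃ λ b → ∣ X ∣ ≤ 2 * ∣ [ X ∣ (λ x → Bool._≟_ (c x) b) ] ∣
      larger-side X c = [ (λ le → false , bound ≤-refl le ) , (λ le → true , bound′ le) ]′ (≤-total ∣ side true ∣ ∣ side false ∣)
        where
        side : Bool → Subset n
        side b = [ X ∣ (λ x → Bool._≟_ (c x) b) ]
        cover : X ⊆ side true ∪ side false
        cover {x} x∈X with c x in cx
        ... | true  = x∈p∪q⁺ (inj₁ (∈-filter⁺ X (λ x → Bool._≟_ (c x) true) x∈X cx))
        ... | false = x∈p∪q⁺ (inj₂ (∈-filter⁺ X (λ x → Bool._≟_ (c x) false) x∈X cx))
        ∣X∣≤ : ∣ X ∣ ≤ ∣ side true ∣ + ∣ side false ∣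
        ∣X∣≤ = ≤-trans (p⊆q⇒∣p∣≤∣q∣ cover) (∣p∪q∣≤∣p∣+∣q∣ (side true) (side false))
        bound : ∀ {m} → ∣ side false ∣ ≤ m → ∣ side true ∣ ≤ m → ∣ X ∣ ≤ 2 * m
        bound {m} f≤ t≤ = ≤-trans ∣X∣≤ (+-mono-≤ t≤ (≤-trans f≤ (≤-reflexive (≡-sym (+-identityʳ m)))))
        bound′ : ∣ side false ∣ ≤ ∣ side true ∣ → ∣ X ∣ ≤ 2 * ∣ side true ∣
        bound′ le = bound le ≤-refl

      -- The factor 4 consists of 2 for keeping the larger side and 2 from `side-bound`. The
      -- ancestor's height d is at most i, hence 2d < τ; a single vertex has no two sides and counts
      -- as a small set.
      connected-bound : ∀ i → i + i < τ → ∀ X → X ⊆ L (suc i) → Nonempty X → Connected G X →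
                        HallBound (4 * s) t X
      connected-bound i 2i<τ X X⊆L (x , x∈X) connected with any? (λ y → (y ∈? X) ×-dec ¬? (x ≟ y))
      ... | no constant =
        let J , indep , bound = small-bound X (≤-trans ∣X∣≤1 1≤M)
        in J , indep , ≤-trans bound (*-monoˡ-≤ ∣ J ∣ (m≤n*m s 4))
        where
        ∣X∣≤1 : ∣ X ∣ ≤ 1
        ∣X∣≤1 = ≤-trans (p⊆q⇒∣p∣≤∣q∣ λ {y} y∈X → subst (_∈ ⁅ x ⁆)
          (decidable-stable (x ≟ y) λ x≢y → constant (y , y∈X , x≢y)) (x∈⁅x⁆ x)) (≤-reflexive (∣⁅x⁆∣≡1 x))
      ... | yes (y , y∈X , x≢y) with split G adj? Z v v∈Z i X id X⊆L x∈X y∈X x≢y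
      ... | d , c , 1≤d , d≤i , (x₁ , x₁∈X , cx₁) , (x₀ , x₀∈X , cx₀) , joined with larger-side X c
      ... | b , half≤ with side-bound i d (≤-<-trans (+-mono-≤ d≤i d≤i) 2i<τ) 1≤d X X⊆L c joined connected b (other b)
        where
        other : ∀ b → ∃ λ w → w ∈ X × c w ≢ b
        other true  = x₀ , x₀∈X , λ eq → case trans (≡-sym cx₀) eq of λ ()
        other false = x₁ , x₁∈X , λ eq → case trans (≡-sym cx₁) eq of λ ()
      ... | J , (J⊆ , indep) , bound = J , (filter⊆ X (λ x → Bool._≟_ (c x) b) ∘ J⊆ , indep) , (begin
        ∣ X ∣ * t              ≤⟨ *-monoˡ-≤ t half≤ ⟩
        2 * ∣ A ∣ * t          ≡⟨ *-assoc 2 ∣ A ∣ t ⟩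
        2 * (∣ A ∣ * t)        ≤⟨ *-monoʳ-≤ 2 bound ⟩
        2 * (2 * s * ∣ J ∣)    ≡⟨ *-assoc 2 (2 * s) ∣ J ∣ ⟨
        2 * (2 * s) * ∣ J ∣    ≡⟨ cong (_* ∣ J ∣) (*-assoc 2 2 s) ⟨
        4 * s * ∣ J ∣          ∎)
        where
        open ≤-Reasoning
        A = [ X ∣ (λ x → Bool._≟_ (c x) b) ]

      -- Components are peeled off whole; each is its own closed neighbourhood in what remains.
      layer-bound : ∀ i → i + i < τ → HallBound (4 * s) t (L (suc i))
      layer-bound i 2i<τ = peel G t (4 * s) (L (suc i)) piece
        where
        piece : ∀ X → X ⊆ L (suc i) → Nonempty X → Piece G t (4 * s) X
        piece X X⊆L X≠∅ with component G adj? X X≠∅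
        ... | C , C⊆X , C≠∅ , closed , connected
          with connected-bound i 2i<τ C (X⊆L ∘ C⊆X) C≠∅ connected
        ... | J , (J⊆C , indep) , bound = record
          { J = J ; N = C ; J⊆N = J⊆C ; N⊆Z = C⊆X ; nonempty = C≠∅ ; indep = C⊆X ∘ J⊆C , indep
          ; nbrs = closed ∘ J⊆C ; bound = bound }

    -- This is ∣X∣/a ≤ 12 (s/t) ∣X∣^(2/τ) without roots; 12 is 3 from `expansion` times 4 from
    -- `layer-bound`. If it fails, `expansion` gives every nonempty Z ⊆ X a layer that grows too
    -- slowly, and peeling these neighbourhoods yields an independent set larger than `a`.
    global-bound : ∀ X → Nonempty X → ∀ a → (∀ J → Independent G X J → ∣ J ∣ ≤ a) →
                   (∣ X ∣ * t) ^ τ ≤ (3 * (4 * s * a)) ^ τ * ∣ X ∣ ^ 2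
    global-bound X X≠∅ a α≤a = decidable-stable (_ ≤? _) absurd
      where
      open ≤-Reasoning
      p u w : ℕ
      p = ∣ X ∣
      u = p * t
      w = 4 * s * a

      module _ (¬goal : ¬ (u ^ τ ≤ (3 * w) ^ τ * p ^ 2)) where

        -- The slow layer gives a∣N∣ < p∣J∣. Multiplying by p and using ∣N∣ ≤ p turns this strict
        -- inequality into ∣N∣(pa + 1) ≤ p²∣J∣, which is linear and survives summation.
        piece : ∀ Z → Z ⊆ X → Nonempty Z → Piece G (suc (p * a)) (p * p) Z
        piece Z Z⊆X (v , v∈Z) with anyUpTo? (λ i → (i + i <? τ) ×-dec (w * (∣ L i ∣ + ∣ L (1 + i) ∣ + ∣ L (2 + i) ∣) <? u * ∣ L (1 + i) ∣)) τ
          where L = layer G adj? Z v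
        ... | no none = contradiction
          (expansion τ u w p (λ i → ∣ L i ∣) (∣⊥∣≡0 n) (x∈p⇒1≤∣p∣ v∈L₁)
            (λ i → p⊆q⇒∣p∣≤∣q∣ (Z⊆X ∘ layer⊆Z G adj? Z v v∈Z i))
            λ i 2i<τ → ≮⇒≥ λ < → none (i , ≤-<-trans (m≤m+n i i) 2i<τ , 2i<τ , <))
          ¬goal
          where
          L = layer G adj? Z v
          v∈L₁ : v ∈ L 1
          v∈L₁ = x∈p∧x∉q⇒x∈p─q (x∈⁅x⁆ v) ∉⊥
        ... | yes (i , _ , 2i<τ , slow) with layer-bound Z v v∈Z i 2i<τ
        ... | J , (J⊆L , indep) , bound = record
          { J = J ; N = N ; J⊆N = L⊆N ∘ J⊆L ; N⊆Z = N⊆Z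
          ; nonempty = let x , x∈ = 1≤∣p∣⇒Nonempty {p = L (suc i)} L≠∅ in x , L⊆N x∈
          ; indep = layer⊆Z G adj? Z v v∈Z (suc i) ∘ J⊆L , indep
          ; nbrs = layer-nbrs G adj? Z v i ∘ J⊆L
          ; bound = begin
              ∣ N ∣ * suc (p * a)          ≡⟨ *-suc ∣ N ∣ (p * a) ⟩
              ∣ N ∣ + ∣ N ∣ * (p * a)      ≤⟨ +-monoˡ-≤ _ (p⊆q⇒∣p∣≤∣q∣ (Z⊆X ∘ N⊆Z)) ⟩
              p + ∣ N ∣ * (p * a)          ≡⟨ cong (p +_) (trans (*-comm ∣ N ∣ (p * a)) (*-assoc p a ∣ N ∣)) ⟩
              p + p * (a * ∣ N ∣)          ≡⟨ *-suc p (a * ∣ N ∣) ⟨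
              p * suc (a * ∣ N ∣)          ≤⟨ *-monoʳ-≤ p a∣N∣<p∣J∣ ⟩
              p * (p * ∣ J ∣)              ≡⟨ *-assoc p p ∣ J ∣ ⟨
              p * p * ∣ J ∣                ∎ }
          where
          L = layer G adj? Z v
          N = L i ∪ L (1 + i) ∪ L (2 + i)
          L⊆N : L (suc i) ⊆ N
          L⊆N x∈ = x∈p∪q⁺ (inj₂ (p⊆p∪q (L (2 + i)) x∈))
          N⊆Z : N ⊆ Z
          N⊆Z x∈ = [ layer⊆Z G adj? Z v v∈Z i ,
            (λ x∈′ → [ layer⊆Z G adj? Z v v∈Z (1 + i) , layer⊆Z G adj? Z v v∈Z (2 + i) ]′
                       (x∈p∪q⁻ (L (1 + i)) (L (2 + i)) x∈′)) ]′ (x∈p∪q⁻ (L i) _ x∈)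
          L≠∅ : 1 ≤ ∣ L (suc i) ∣
          L≠∅ = n≢0⇒n>0 λ ≡0 → contradiction slow (≤⇒≯ (subst (_≤ w * (∣ L i ∣ + ∣ L (1 + i) ∣ + ∣ L (2 + i) ∣))
            (≡-sym (trans (cong (u *_) ≡0) (*-zeroʳ u))) z≤n))
          a∣N∣<p∣J∣ : a * ∣ N ∣ < p * ∣ J ∣
          a∣N∣<p∣J∣ = *-cancelˡ-< (4 * s) _ _ (begin-strict
            4 * s * (a * ∣ N ∣)    ≡⟨ *-assoc (4 * s) a ∣ N ∣ ⟨
            w * ∣ N ∣              ≤⟨ *-monoʳ-≤ w (begin
              ∣ N ∣                                              ≤⟨ ∣p∪q∣≤∣p∣+∣q∣ (L i) _ ⟩
              ∣ L i ∣ + ∣ L (1 + i) ∪ L (2 + i) ∣                ≤⟨ +-monoʳ-≤ ∣ L i ∣ (∣p∪q∣≤∣p∣+∣q∣ (L (1 + i)) _) ⟩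
              ∣ L i ∣ + (∣ L (1 + i) ∣ + ∣ L (2 + i) ∣)          ≡⟨ +-assoc ∣ L i ∣ _ _ ⟨
              ∣ L i ∣ + ∣ L (1 + i) ∣ + ∣ L (2 + i) ∣            ∎) ⟩
            w * (∣ L i ∣ + ∣ L (1 + i) ∣ + ∣ L (2 + i) ∣)        <⟨ slow ⟩
            p * t * ∣ L (suc i) ∣            ≡⟨ *-assoc p t _ ⟩
            p * (t * ∣ L (suc i) ∣)          ≡⟨ cong (p *_) (*-comm t _) ⟩
            p * (∣ L (suc i) ∣ * t)          ≤⟨ *-monoʳ-≤ p bound ⟩
            p * (4 * s * ∣ J ∣)    ≡⟨ *-assoc p (4 * s) ∣ J ∣ ⟨
            p * (4 * s) * ∣ J ∣    ≡⟨ cong (_* ∣ J ∣) (*-comm p (4 * s)) ⟩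
            4 * s * p * ∣ J ∣      ≡⟨ *-assoc (4 * s) p ∣ J ∣ ⟩
            4 * s * (p * ∣ J ∣)    ∎)

        absurd : Data.Empty.⊥
        absurd with peel G (suc (p * a)) (p * p) X piece
        ... | J , indep , bound = contradiction (begin
          suc (p * (p * a))      ≤⟨ +-monoˡ-≤ (p * (p * a)) (x∈p⇒1≤∣p∣ (proj₂ X≠∅)) ⟩
          p + p * (p * a)        ≡⟨ *-suc p (p * a) ⟨
          p * suc (p * a)        ≤⟨ bound ⟩
          p * p * ∣ J ∣          ≤⟨ *-monoʳ-≤ (p * p) (α≤a J indep) ⟩
          p * p * a              ≡⟨ *-assoc p p a ⟩
          p * (p * a)            ∎) (<-irrefl refl)

  -- Independence numbers and the extremal small set

  independent? : ∀ X → Decidable (Independent G X)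
  independent? X J = (J ⊆? X) ×-dec map′ (λ f {u} {v} → f u v) (λ f u v → f {u} {v})
    (all? λ u → all? λ v → (u ∈? J) →-dec ((v ∈? J) →-dec ¬? (adj? u v)))

  maxIndependent : ∀ X → ∃ λ J → Independent G X J × (∀ {I} → Independent G X I → ∣ I ∣ ≤ ∣ J ∣)
  maxIndependent X = maximal {_≼_ = λ p q → ∣ p ∣ ≤ ∣ q ∣} (independent? X) (λ _ → ≤-refl)
    (λ {p} {q} _ _ → ≤-total ∣ p ∣ ∣ q ∣) (λ _ _ _ → ≤-trans) (⊥ , ⊥⊆ , λ u∈ → contradiction u∈ ∉⊥)

  α : Subset n → ℕ
  α X = ∣ proj₁ (maxIndependent X) ∣

  1≤α : ∀ {X} → Nonempty X → 1 ≤ α X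
  1≤α {X} (x , x∈X) = subst (_≤ α X) (∣⁅x⁆∣≡1 x) (proj₂ (proj₂ (maxIndependent X)) {⁅ x ⁆}
    ((λ y∈ → subst (_∈ X) (≡-sym (x∈⁅y⁆⇒x≡y x y∈)) x∈X) ,
     λ u∈ v∈ e → irrefl G (subst₂ (Adj G) (x∈⁅y⁆⇒x≡y x u∈) (x∈⁅y⁆⇒x≡y x v∈) e)))

  -- `R` maximises ∣R∣/α(R) among nonempty sets of at most M vertices. Its two counts represent the
  -- largest ratio exactly, and `R` is the set to which the induction is applied.
  extremalSmallSet : ∀ M → 1 ≤ M → Fin n → ∃ λ R → Nonempty R × ∣ R ∣ ≤ M ×
                     (∀ X → ∣ X ∣ ≤ M → HallBound ∣ R ∣ (α R) X)
  extremalSmallSet M 1≤M x =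
    let R , (R≠∅ , R≤M) , max = maximal {P = P} {_≼_} (λ X → nonempty? X ×-dec (∣ X ∣ ≤? M))
          (λ _ → ≤-refl) (λ _ _ → ≤-total _ _)
          (λ {p} {q} {r} → ≼-trans p q r) (⁅ x ⁆ , (x , x∈⁅x⁆ x) , subst (_≤ M) (≡-sym (∣⁅x⁆∣≡1 x)) 1≤M)
    in R , R≠∅ , R≤M , λ X X≤M → bound R max X X≤M
    where
    P : Subset n → Set
    P X = Nonempty X × ∣ X ∣ ≤ M
    _≼_ : Subset n → Subset n → Set
    X ≼ Y = ∣ X ∣ * α Y ≤ ∣ Y ∣ * α X
    open ≤-Reasoning
    ≼-trans : ∀ p q r → P p → P q → P r → p ≼ q → q ≼ r → p ≼ r
    ≼-trans p q r _ (q≠∅ , _) _ p≼q q≼r = *-cancelʳ-≤ _ _ (α q) ⦃ >-nonZero (1≤α q≠∅) ⦄ (begin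
      ∣ p ∣ * α r * α q      ≡⟨ *-assoc ∣ p ∣ (α r) (α q) ⟩
      ∣ p ∣ * (α r * α q)    ≡⟨ cong (∣ p ∣ *_) (*-comm (α r) (α q)) ⟩
      ∣ p ∣ * (α q * α r)    ≡⟨ *-assoc ∣ p ∣ (α q) (α r) ⟨
      ∣ p ∣ * α q * α r      ≤⟨ *-monoˡ-≤ (α r) p≼q ⟩
      ∣ q ∣ * α p * α r      ≡⟨ *-assoc ∣ q ∣ (α p) (α r) ⟩
      ∣ q ∣ * (α p * α r)    ≡⟨ cong (∣ q ∣ *_) (*-comm (α p) (α r)) ⟩
      ∣ q ∣ * (α r * α p)    ≡⟨ *-assoc ∣ q ∣ (α r) (α p) ⟨
      ∣ q ∣ * α r * α p      ≤⟨ *-monoˡ-≤ (α p) q≼r ⟩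
      ∣ r ∣ * α q * α p      ≡⟨ *-assoc ∣ r ∣ (α q) (α p) ⟩
      ∣ r ∣ * (α q * α p)    ≡⟨ cong (∣ r ∣ *_) (*-comm (α q) (α p)) ⟩
      ∣ r ∣ * (α p * α q)    ≡⟨ *-assoc ∣ r ∣ (α p) (α q) ⟨
      ∣ r ∣ * α p * α q      ∎)
    bound : ∀ R → (∀ {X} → P X → X ≼ R) → ∀ X → ∣ X ∣ ≤ M → HallBound ∣ R ∣ (α R) X
    bound R max X X≤M with nonempty? X
    ... | yes X≠∅ = proj₁ (maxIndependent X) , proj₁ (proj₂ (maxIndependent X)) , max (X≠∅ , X≤M)
    ... | no empty = ⊥ , (⊥⊆ , λ u∈ → contradiction u∈ ∉⊥) ,
      subst (λ m → m * α R ≤ ∣ R ∣ * ∣ ⊥ {n} ∣) (≡-sym (trans (cong ∣_∣ (Empty-unique empty)) (∣⊥∣≡0 n))) z≤n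

-- Powers and products

^-distribʳ-* : ∀ k x y → (x * y) ^ k ≡ x ^ k * y ^ k
^-distribʳ-* zero    x y = refl
^-distribʳ-* (suc k) x y = trans (cong (x * y *_) (^-distribʳ-* k x y)) ([m*n]*[o*p]≡[m*o]*[n*p] x y (x ^ k) (y ^ k))

reindex : ∀ {f : ℕ → ℕ} {r} → prod0 f r ≡ prod0 f r → ℕ → ℕ
reindex {f} _ = f

-- The factors of coprod f r k are recovered by unification, as Defs does not name them.
coprodFactor : (ℕ → ℕ) → ℕ → ℕ → ℕ → ℕ
coprodFactor f r k = reindex {r = r} (refl {x = coprod f r k})

coprodFactor-self : ∀ f r k → coprodFactor f r k k ≡ 1
coprodFactor-self f r k with k ℕ.≟ k
... | yes _ = refl
... | no ≢  = contradiction refl ≢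

coprodFactor-other : ∀ f r k {i} → i ≢ k → coprodFactor f r k i ≡ f i
coprodFactor-other f r k {i} i≢k with i ℕ.≟ k
... | yes eq = contradiction eq i≢k
... | no _   = refl

coprodFactor-irrelevant : ∀ f r r′ k i → coprodFactor f r k i ≡ coprodFactor f r′ k i
coprodFactor-irrelevant f r r′ k i with i ℕ.≟ k
... | yes _ = refl
... | no _  = refl

prod0-cong : ∀ {f g} r → (∀ i → i ≤ r → f i ≡ g i) → prod0 f r ≡ prod0 g r
prod0-cong zero    f≡g = f≡g 0 z≤n
prod0-cong (suc r) f≡g =
  cong₂ _*_ (prod0-cong r λ i i≤r → f≡g i (m≤n⇒m≤1+n i≤r)) (f≡g (suc r) ≤-refl)

coprod-suc : ∀ f r {k} → k ≤ r → coprod f (suc r) k ≡ coprod f r k * f (suc r)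
coprod-suc f r {k} k≤r = cong₂ _*_ (prod0-cong r λ i _ → coprodFactor-irrelevant f (suc r) r k i)
  (coprodFactor-other f (suc r) k (<⇒≢ (s≤s k≤r) ∘ ≡-sym))

coprod-last : ∀ f r → coprod f (suc r) (suc r) ≡ prod0 f r
coprod-last f r = trans (cong₂ _*_
  (prod0-cong r λ i i≤r → coprodFactor-other f (suc r) (suc r) (<⇒≢ (s≤s i≤r)))
  (coprodFactor-self f (suc r) (suc r))) (*-identityʳ _)

prod0≡coprod*last : ∀ f r → prod0 f r ≡ coprod f r r * f r
prod0≡coprod*last f zero    = ≡-sym (*-identityˡ (f 0))
prod0≡coprod*last f (suc r) = cong (_* f (suc r)) (≡-sym (coprod-last f r))

prod1-^ : ∀ f g k r → (∀ i → 1 ≤ i → i ≤ r → f i ≡ g i ^ k) → prod1 f r ≡ prod1 g r ^ k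
prod1-^ f g k zero    f≡g = ≡-sym (^-zeroˡ k)
prod1-^ f g k (suc r) f≡g = trans
  (cong₂ _*_ (prod1-^ f g k r λ i 1≤i i≤r → f≡g i 1≤i (m≤n⇒m≤1+n i≤r)) (f≡g (suc r) (s≤s z≤n) ≤-refl))
  (≡-sym (^-distribʳ-* k (prod1 g r) (g (suc r))))

-- Equivalently x^(2/x) ≤ 9/4. In the induction step x² grows by a factor of at most 9/4, since 2(x
-- + 1) ≤ 3x.
4^x*x²≤9^x : ∀ x → 3 ≤ x → 4 ^ x * (x * x) ≤ 9 ^ x
4^x*x²≤9^x (suc zero)             (s≤s ())
4^x*x²≤9^x (suc (suc zero))       (s≤s (s≤s ()))
4^x*x²≤9^x (suc (suc (suc zero))) _ = ≤ᵇ⇒≤ _ _ _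
4^x*x²≤9^x (suc x@(suc (suc (suc y)))) _ = begin
  4 * 4 ^ x * (suc x * suc x)      ≡⟨ rearrange (4 ^ x) x ⟩
  4 ^ x * ((2 * suc x) * (2 * suc x)) ≤⟨ *-monoʳ-≤ (4 ^ x) (*-mono-≤ 2[1+x]≤3x 2[1+x]≤3x) ⟩
  4 ^ x * ((3 * x) * (3 * x))      ≡⟨ rearrange′ (4 ^ x) x ⟩
  9 * (4 ^ x * (x * x))            ≤⟨ *-monoʳ-≤ 9 (4^x*x²≤9^x x (s≤s (s≤s (s≤s z≤n)))) ⟩
  9 * 9 ^ x                        ∎
  where
  open ≤-Reasoning
  rearrange : ∀ p x → 4 * p * (suc x * suc x) ≡ p * ((2 * suc x) * (2 * suc x))
  rearrange = solve-∀
  rearrange′ : ∀ p x → p * ((3 * x) * (3 * x)) ≡ 9 * (p * (x * x))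
  rearrange′ = solve-∀
  split-3x : ∀ y → 3 * (3 + y) ≡ 2 * (4 + y) + (1 + y)
  split-3x = solve-∀
  2[1+x]≤3x : 2 * suc x ≤ 3 * x
  2[1+x]≤3x = subst (2 * suc x ≤_) (≡-sym (split-3x y)) (m≤m+n (2 * suc x) (1 + y))

-- The sequences σ and τ and their gaps

module _ (σ φ : ℕ → ℕ) (σ-step : ∀ j → j ≥ 1 → σ j < σ (suc j)) (3≤σ₁ : σ 1 ≥ 3)
         (1≤φ₁ : φ 1 ≥ 1) (φ-step : ∀ i → i ≥ 1 → φ i < φ (suc i)) (σφ₁≡σ₁ : σ (φ 1) ≡ σ 1) where

  private
    τ Δ L : ℕ → ℕ
    τ = tau σ φ
    Δ = delta σ φ
    L = prod0 τ

    e : ℕ → ℕ → ℕ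
    e = coprod τ

    -- As `e r k` is L r / τ k, this is the power with exponent `L r` of the factor exp(∑ 2 log △_i
    -- / τ_(i-1)).
    Π : ℕ → ℕ
    Π r = prod1 (λ i → Δ i ^ (2 * e r (i ∸ 1))) r

  σ-mono : ∀ {i j} → 1 ≤ i → i ≤ j → σ i ≤ σ j
  σ-mono {i} {j} 1≤i i≤j with m≤n⇒m<n∨m≡n i≤j
  ... | inj₂ refl = ≤-refl
  σ-mono {i} {suc j} 1≤i i≤j | inj₁ i<1+j =
    ≤-trans (σ-mono 1≤i (s≤s⁻¹ i<1+j)) (<⇒≤ (σ-step j (≤-trans 1≤i (s≤s⁻¹ i<1+j))))

  j≤σj : ∀ j → 1 ≤ j → j ≤ σ j
  j≤σj (suc zero)    _ = ≤-trans (s≤s z≤n) 3≤σ₁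
  j≤σj (suc (suc j)) _ = ≤-<-trans (j≤σj (suc j) (s≤s z≤n)) (σ-step (suc j) (s≤s z≤n))

  i≤φi : ∀ i → 1 ≤ i → i ≤ φ i
  i≤φi (suc zero)    _ = 1≤φ₁
  i≤φi (suc (suc i)) _ = ≤-<-trans (i≤φi (suc i) (s≤s z≤n)) (φ-step (suc i) (s≤s z≤n))

  σ₁≤τ : ∀ r → σ 1 ≤ τ (suc r)
  σ₁≤τ r = σ-mono ≤-refl (≤-trans (s≤s z≤n) (i≤φi (suc r) (s≤s z≤n)))

  τ-step : ∀ r → τ (suc r) ≤ τ (2 + r)
  τ-step r = σ-mono (≤-trans (s≤s z≤n) (i≤φi (suc r) (s≤s z≤n))) (<⇒≤ (φ-step (suc r) (s≤s z≤n)))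

  lastGap≤maxGap : ∀ B K → σ (2 + K) ≤ B → σ (2 + K) ∸ σ (1 + K) ≤ maxGapUpTo σ B (2 + K)
  lastGap≤maxGap B K σ≤B with σ (2 + K) ≤ᵇ B | ≤⇒≤ᵇ σ≤B
  ... | true | _ = m≤n⊔m (maxGapUpTo σ B (suc K)) _

  gap≤maxGap : ∀ B K j → 1 ≤ j → suc j ≤ K → σ (suc j) ≤ B → σ (suc j) ∸ σ j ≤ maxGapUpTo σ B K
  gap≤maxGap B (suc zero) (suc j) _ (s≤s ()) _
  gap≤maxGap B (suc (suc K)) (suc j) 1≤j j≤K σ≤B =
    [ (λ j<K → ≤-trans (gap≤maxGap B (suc K) (suc j) 1≤j (s≤s⁻¹ j<K) σ≤B) (m≤m⊔n _ _))
    , (λ { refl → lastGap≤maxGap B K σ≤B }) ]′ (m≤n⇒m<n∨m≡n j≤K)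

  gap≤Δ : ∀ r j → 1 ≤ j → σ (suc j) ≤ τ (2 + r) → σ (suc j) ∸ σ j ≤ Δ (2 + r)
  gap≤Δ r j 1≤j σ≤τ = gap≤maxGap _ _ j 1≤j (≤-trans (j≤σj (suc j) (s≤s z≤n)) σ≤τ) σ≤τ

  1≤Δ : ∀ r → 1 ≤ Δ (suc r)
  1≤Δ zero    = ≤-refl
  1≤Δ (suc r) = ≤-trans (m<n⇒0<n∸m (σ-step 1 ≤-refl)) (gap≤Δ r 1 ≤-refl
    (σ-mono (s≤s z≤n) (≤-trans (s≤s (s≤s z≤n)) (i≤φi (2 + r) (s≤s z≤n)))))

  Bracket : ℕ → ℕ → Set
  Bracket m k = m < σ 1 ⊎ ∃ λ j → 1 ≤ j × suc j ≤ k × σ j ≤ m × m < σ (suc j)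

  bracket : ∀ m k → 1 ≤ k → m < σ k → Bracket m k
  bracket m (suc zero)    _ m<  = inj₁ m<
  bracket m (suc (suc k)) _ m<σ = extend (m <? σ (suc k)) (bracket m (suc k) (s≤s z≤n))
    where
    extend : Dec (m < σ (suc k)) → (m < σ (suc k) → Bracket m (suc k)) → Bracket m (2 + k)
    extend (no m≮) _ = inj₂ (suc k , s≤s z≤n , ≤-refl , ≮⇒≥ m≮ , m<σ)
    extend (yes m<) rec = [ inj₁ , (λ (j , 1≤j , j≤k , rest) → inj₂ (j , 1≤j , m≤n⇒m≤1+n j≤k , rest)) ]′ (rec m<)

  -- Either m < σ₁, and σ₁ is near enough, or m lies between consecutive terms, which differ by at
  -- most △. The product σ₁△ covers both cases; the second cannot occur for τ₁ = σ₁.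
  window : ∀ r m → m < τ (suc r) →
           ∃ λ j → 1 ≤ j × σ j ≤ τ (suc r) × m < σ j × σ j ∸ m ≤ σ 1 * Δ (suc r)
  window r m m<τ with bracket m (φ (suc r)) (≤-trans (s≤s z≤n) (i≤φi (suc r) (s≤s z≤n))) m<τ
  ... | inj₁ m<σ₁ = 1 , ≤-refl , σ₁≤τ r , m<σ₁ ,
                    ≤-trans (m∸n≤m (σ 1) m) (m≤m*n (σ 1) (Δ (suc r)) ⦃ >-nonZero (1≤Δ r) ⦄)
  ... | inj₂ (j , 1≤j , j<φ , σj≤m , m<σ) = late r (σ-mono (s≤s z≤n) j<φ) m<τ
    where
    late : ∀ r → σ (suc j) ≤ τ (suc r) → m < τ (suc r) →
           ∃ λ j → 1 ≤ j × σ j ≤ τ (suc r) × m < σ j × σ j ∸ m ≤ σ 1 * Δ (suc r)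
    late zero _ m<τ₁ = contradiction (<-≤-trans (subst (m <_) σφ₁≡σ₁ m<τ₁) (σ-mono ≤-refl 1≤j)) (≤⇒≯ σj≤m)
    late (suc r) σ≤τ _ = suc j , s≤s z≤n , σ≤τ , m<σ ,
      ≤-trans (∸-monoʳ-≤ (σ (suc j)) σj≤m) (≤-trans (gap≤Δ r j 1≤j σ≤τ)
        (m≤n*m (Δ (2 + r)) (σ 1) ⦃ >-nonZero (≤-trans (s≤s z≤n) 3≤σ₁) ⦄))

  -- Passing to r + 1 multiplies the common exponent L by τ_(r+1), so each old factor is raised to
  -- that power and one new factor appears.
  Π-suc : ∀ r → Π (suc r) ≡ (Π r * Δ (suc r) ^ (2 * e r r)) ^ τ (suc r)
  Π-suc r = trans (cong₂ _*_
      (prod1-^ _ (λ i → Δ i ^ (2 * e r (i ∸ 1))) T r λ i 1≤i i≤r → power (Δ i) (≤-trans (m∸n≤m i 1) i≤r))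
      (power (Δ (suc r)) ≤-refl))
    (≡-sym (^-distribʳ-* T (Π r) _))
    where
    T = τ (suc r)
    power : ∀ x {k} → k ≤ r → x ^ (2 * e (suc r) k) ≡ (x ^ (2 * e r k)) ^ T
    power x {k} k≤r = trans (cong (x ^_) (trans (cong (2 *_) (coprod-suc τ r k≤r)) (≡-sym (*-assoc 2 (e r k) T))))
      (≡-sym (^-*-assoc x (2 * e r k) T))

  -- Induction on r

  module _ {n : ℕ} (G : Graph n) (adj? : ∀ u v → Dec (Adj G u v)) where

    Avoids : ℕ → Set
    Avoids r = ∀ j → j ≥ 1 → σ j ≤ τ r → ¬ HasCycle G (σ j)

    -- ∣X∣ stands where the theorem has n: the induction applies this to sets of at most σ₁△
    -- vertices, and the gain lies in their small size.
    HasBound : ℕ → Set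
    HasBound r = ∀ X → Nonempty X → ∀ a → (∀ J → Independent G X J → ∣ J ∣ ≤ a) →
      ∣ X ∣ ^ L r < (27 ^ r * σ 1 * a) ^ L r * Π r * ∣ X ∣ ^ (2 * e r r)

    no-cycle : ∀ r → Avoids (suc r) → ∀ d → 1 ≤ d → d + d < τ (suc r) →
               ∃ λ l → 1 ≤ l × l ≤ σ 1 * Δ (suc r) × ¬ HasCycle G (l + (d + d))
    no-cycle r avoids d _ 2d<τ with window r (d + d) 2d<τ
    ... | j , 1≤j , σj≤τ , 2d<σj , ≤M =
      σ j ∸ (d + d) , m<n⇒0<n∸m 2d<σj , ≤M ,
      subst (λ l → ¬ HasCycle G l) (≡-sym (m∸n+n≡m (<⇒≤ 2d<σj))) (avoids j 1≤j σj≤τ)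

    -- The factor 12 is the loss of global-bound; 27/12 = 9/4 pays for replacing
    -- M = σ₁ △ by △, because M ^ (2 / τ) ≤ (9/4) △ ^ (2 / τ) for σ₁ ≤ τ.
    small-set-bound : ∀ r → Avoids (suc r) → (∀ r′ → r ≡ suc r′ → HasBound r) → ∀ R → Nonempty R →
      ∣ R ∣ ≤ σ 1 * Δ (suc r) →
      (12 * ∣ R ∣) ^ L r < (27 ^ suc r * σ 1 * α G adj? R) ^ L r * (Π r * Δ (suc r) ^ (2 * e r r))
    -- Here △₁ = 1 and all exponents are 1, so ∣R∣ ≤ σ₁ and 12 < 27 suffice.
    small-set-bound zero _ _ R R≠∅ R≤M = begin-strict
      12 * s * 1                       ≡⟨ *-identityʳ (12 * s) ⟩
      12 * s                           ≤⟨ *-monoʳ-≤ 12 (≤-trans R≤M (≤-reflexive (*-identityʳ (σ 1)))) ⟩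
      12 * σ 1                         <⟨ *-monoˡ-< (σ 1) ⦃ >-nonZero (≤-trans (s≤s z≤n) 3≤σ₁) ⦄ (≤ᵇ⇒≤ 13 27 _) ⟩
      27 * σ 1                         ≤⟨ m≤m*n (27 * σ 1) t ⦃ >-nonZero (1≤α G adj? R≠∅) ⦄ ⟩
      27 * σ 1 * t                     ≡⟨ trans (*-identityʳ _) (*-identityʳ _) ⟨
      27 * σ 1 * t * 1 * 1             ∎
      where
      open ≤-Reasoning
      s = ∣ R ∣
      t = α G adj? R
    small-set-bound (suc r′) avoids hyp R R≠∅ R≤M = begin-strict
      (12 * s) ^ ℓ                                     ≡⟨ ^-distribʳ-* ℓ 12 s ⟩
      12 ^ ℓ * s ^ ℓ                                   <⟨ *-monoʳ-< (12 ^ ℓ) ⦃ m^n≢0 12 ℓ ⦄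
                                                           (hyp r′ refl R R≠∅ t λ J indep → proj₂ (proj₂ (maxIndependent G adj? R)) indep) ⟩
      12 ^ ℓ * (c ^ ℓ * Π r * s ^ (2 * k))             ≤⟨ *-monoʳ-≤ (12 ^ ℓ) (*-monoʳ-≤ (c ^ ℓ * Π r) (^-monoˡ-≤ (2 * k) R≤M)) ⟩
      12 ^ ℓ * (c ^ ℓ * Π r * M ^ (2 * k))             ≡⟨ cong (_* (c ^ ℓ * Π r * M ^ (2 * k))) (^-distribʳ-* ℓ 3 4) ⟩
      3 ^ ℓ * 4 ^ ℓ * (c ^ ℓ * Π r * M ^ (2 * k))      ≡⟨ rearrange (3 ^ ℓ) (4 ^ ℓ) (c ^ ℓ) (Π r) (M ^ (2 * k)) ⟩
      3 ^ ℓ * c ^ ℓ * Π r * (4 ^ ℓ * M ^ (2 * k))      ≤⟨ *-monoʳ-≤ (3 ^ ℓ * c ^ ℓ * Π r) absorb ⟩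
      3 ^ ℓ * c ^ ℓ * Π r * (9 ^ ℓ * D ^ (2 * k))      ≡⟨ rearrange′ (3 ^ ℓ) (9 ^ ℓ) (c ^ ℓ) (Π r) (D ^ (2 * k)) ⟩
      3 ^ ℓ * 9 ^ ℓ * c ^ ℓ * (Π r * D ^ (2 * k))      ≡⟨ cong (λ x → x * c ^ ℓ * (Π r * D ^ (2 * k))) (^-distribʳ-* ℓ 3 9) ⟨
      27 ^ ℓ * c ^ ℓ * (Π r * D ^ (2 * k))             ≡⟨ cong (_* (Π r * D ^ (2 * k))) (^-distribʳ-* ℓ 27 c) ⟨
      (27 * c) ^ ℓ * (Π r * D ^ (2 * k))               ≡⟨ cong (λ x → x ^ ℓ * (Π r * D ^ (2 * k))) (assoc 27 (27 ^ r) (σ 1) t) ⟩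
      (27 * 27 ^ r * σ 1 * t) ^ ℓ * (Π r * D ^ (2 * k)) ∎
      where
      open ≤-Reasoning
      r = suc r′
      ℓ = L r
      k = e r r
      s = ∣ R ∣
      t = α G adj? R
      c = 27 ^ r * σ 1 * t
      D = Δ (suc r)
      M = σ 1 * D
      rearrange : ∀ x y z p q → x * y * (z * p * q) ≡ x * z * p * (y * q)
      rearrange = solve-∀
      rearrange′ : ∀ x y z p q → x * z * p * (y * q) ≡ x * y * z * (p * q)
      rearrange′ = solve-∀
      assoc : ∀ x y z p → x * (y * z * p) ≡ x * y * z * p
      assoc = solve-∀
      square : ∀ x y → x * y * (x * y) ≡ x * x * (y * y)
      square = solve-∀

      power : ∀ x → x ^ (2 * k) ≡ (x * x) ^ k
      power x = trans (≡-sym (^-*-assoc x 2 k)) (cong (_^ k) (≡-sym (m*m≡m^2 x)))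

      x^ℓ : ∀ x → x ^ ℓ ≡ (x ^ τ r) ^ k
      x^ℓ x = trans (cong (x ^_) (trans (prod0≡coprod*last τ r) (*-comm k (τ r)))) (≡-sym (^-*-assoc x (τ r) k))

      -- Since ℓ = k τ_r, both sides are k-th powers, and it suffices that 4^τ_r σ₁² ≤ 9^τ_r.
      absorb : 4 ^ ℓ * M ^ (2 * k) ≤ 9 ^ ℓ * D ^ (2 * k)
      absorb = begin
        4 ^ ℓ * M ^ (2 * k)                    ≡⟨ cong₂ _*_ (x^ℓ 4) (power M) ⟩
        (4 ^ τ r) ^ k * (M * M) ^ k            ≡⟨ ^-distribʳ-* k (4 ^ τ r) (M * M) ⟨
        (4 ^ τ r * (M * M)) ^ k                ≤⟨ ^-monoˡ-≤ k (begin
          4 ^ τ r * (M * M)                      ≡⟨ cong (4 ^ τ r *_) (square (σ 1) D) ⟩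
          4 ^ τ r * (σ 1 * σ 1 * (D * D))        ≡⟨ *-assoc (4 ^ τ r) (σ 1 * σ 1) (D * D) ⟨
          4 ^ τ r * (σ 1 * σ 1) * (D * D)        ≤⟨ *-monoˡ-≤ (D * D) (≤-trans
                                                     (*-monoʳ-≤ (4 ^ τ r) (*-mono-≤ (σ₁≤τ r′) (σ₁≤τ r′)))
                                                     (4^x*x²≤9^x (τ r) (≤-trans 3≤σ₁ (σ₁≤τ r′)))) ⟩
          9 ^ τ r * (D * D)                      ∎) ⟩
        (9 ^ τ r * (D * D)) ^ k                ≡⟨ ^-distribʳ-* k (9 ^ τ r) (D * D) ⟩
        (9 ^ τ r) ^ k * (D * D) ^ k            ≡⟨ cong₂ _*_ (x^ℓ 9) (power D) ⟨
        9 ^ ℓ * D ^ (2 * k)                    ∎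

    -- `global-bound` compares X with the extremal `R`, and `small-set-bound` bounds `R`. They come
    -- with exponents T and ℓ, so each is raised to the other's exponent; then the power of α(R)
    -- cancels.
    hasBound : ∀ r → Avoids (suc r) → HasBound (suc r)
    hasBound r avoids X X≠∅ a α≤a
      with extremalSmallSet G adj? (σ 1 * Δ (suc r)) (*-mono-≤ (≤-trans (s≤s z≤n) 3≤σ₁) (1≤Δ r)) (proj₁ X≠∅)
    ... | R , R≠∅ , R≤M , extremal = *-cancelʳ-< (t ^ (ℓ * T)) (p ^ (ℓ * T)) _ (begin-strict
      p ^ (ℓ * T) * t ^ (ℓ * T)                        ≡⟨ ^-distribʳ-* (ℓ * T) p t ⟨
      (p * t) ^ (ℓ * T)                                ≡⟨ cong ((p * t) ^_) (*-comm ℓ T) ⟩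
      (p * t) ^ (T * ℓ)                                ≡⟨ ^-*-assoc (p * t) T ℓ ⟨
      ((p * t) ^ T) ^ ℓ                                ≤⟨ ^-monoˡ-≤ ℓ (global-bound G adj? T (σ 1 * Δ (suc r)) s t
                                                           (*-mono-≤ (≤-trans (s≤s z≤n) 3≤σ₁) (1≤Δ r)) extremal (no-cycle r avoids) X X≠∅ a α≤a) ⟩
      ((3 * (4 * s * a)) ^ T * p ^ 2) ^ ℓ              ≡⟨ ^-distribʳ-* ℓ _ (p ^ 2) ⟩
      ((3 * (4 * s * a)) ^ T) ^ ℓ * (p ^ 2) ^ ℓ        ≡⟨ cong₂ _*_ (trans (^-*-assoc _ T ℓ) (cong₂ _^_ (assoc s a) (*-comm T ℓ))) (^-*-assoc p 2 ℓ) ⟩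
      (12 * s * a) ^ (ℓ * T) * p ^ (2 * ℓ)             ≡⟨ cong (_* p ^ (2 * ℓ)) (^-distribʳ-* (ℓ * T) (12 * s) a) ⟩
      (12 * s) ^ (ℓ * T) * a ^ (ℓ * T) * p ^ (2 * ℓ)   ≡⟨ *-assoc ((12 * s) ^ (ℓ * T)) _ _ ⟩
      (12 * s) ^ (ℓ * T) * q                           ≡⟨ cong (_* q) (^-*-assoc (12 * s) ℓ T) ⟨
      ((12 * s) ^ ℓ) ^ T * q                           <⟨ *-monoˡ-< q (^-monoˡ-< T
                                                           (small-set-bound r avoids (previous r avoids) R R≠∅ R≤M)) ⟩
      ((C * t) ^ ℓ * E) ^ T * q                        ≡⟨ cong (_* q) (^-distribʳ-* T ((C * t) ^ ℓ) E) ⟩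
      ((C * t) ^ ℓ) ^ T * E ^ T * q                    ≡⟨ cong₂ (λ x y → x * y * q) (^-*-assoc (C * t) ℓ T) (≡-sym (Π-suc r)) ⟩
      (C * t) ^ (ℓ * T) * Π (suc r) * q                ≡⟨ cong (λ x → x * Π (suc r) * q) (^-distribʳ-* (ℓ * T) C t) ⟩
      C ^ (ℓ * T) * t ^ (ℓ * T) * Π (suc r) * (a ^ (ℓ * T) * p ^ (2 * ℓ))
                                                       ≡⟨ rearrange (C ^ (ℓ * T)) (t ^ (ℓ * T)) (Π (suc r)) (a ^ (ℓ * T)) (p ^ (2 * ℓ)) ⟩
      C ^ (ℓ * T) * a ^ (ℓ * T) * Π (suc r) * p ^ (2 * ℓ) * t ^ (ℓ * T)
                                                       ≡⟨ cong₂ (λ x y → x * Π (suc r) * p ^ (2 * y) * t ^ (ℓ * T))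
                                                           (≡-sym (^-distribʳ-* (ℓ * T) C a)) (≡-sym (coprod-last τ r)) ⟩
      (C * a) ^ (ℓ * T) * Π (suc r) * p ^ (2 * e (suc r) (suc r)) * t ^ (ℓ * T) ∎)
      where
      open ≤-Reasoning
      -- Since τ increases, the lengths forbidden up to τ_(r+1) include those up to τ_r.
      previous : ∀ r → Avoids (suc r) → ∀ r′ → r ≡ suc r′ → HasBound r
      previous _ avoids r′ refl = hasBound r′ λ j 1≤j σj≤ → avoids j 1≤j (≤-trans σj≤ (τ-step r′))
      p = ∣ X ∣
      s = ∣ R ∣
      t = α G adj? R
      ℓ = L r
      T = τ (suc r)
      C = 27 ^ suc r * σ 1
      E = Π r * Δ (suc r) ^ (2 * e r r)
      q = a ^ (ℓ * T) * p ^ (2 * ℓ)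
      1≤a : 1 ≤ a
      1≤a = ≤-trans (1≤α G adj? X≠∅) (α≤a _ (proj₁ (proj₂ (maxIndependent G adj? X))))
      instance
        T≢0 : NonZero T
        T≢0 = >-nonZero (≤-trans (s≤s z≤n) (≤-trans 3≤σ₁ (σ₁≤τ r)))
        q≢0 : NonZero q
        q≢0 = m*n≢0 (a ^ (ℓ * T)) (p ^ (2 * ℓ)) ⦃ m^n≢0 a (ℓ * T) ⦃ >-nonZero 1≤a ⦄ ⦄
                ⦃ m^n≢0 p (2 * ℓ) ⦃ >-nonZero (x∈p⇒1≤∣p∣ (proj₂ X≠∅)) ⦄ ⦄
      assoc : ∀ s a → 3 * (4 * s * a) ≡ 12 * s * a
      assoc = solve-∀
      rearrange : ∀ c t x a p → c * t * x * (a * p) ≡ c * a * x * p * t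
      rearrange = solve-∀

-- The inequality for a single `X`, cleared of the logarithms and fractions by raising it to the
-- power τ_0 ⋯ τ_r. As G has finitely many vertex subsets, the supremum is attained, so strictness
-- passes to ι(G).
theorem7 : (σ φ : ℕ → ℕ)
    → (∀ j → j ≥ 1 → σ j < σ (suc j))
    → σ 1 ≥ 3
    → φ 1 ≥ 1
    → (∀ i → i ≥ 1 → φ i < φ (suc i))
    → σ (φ 1) ≡ σ 1
    → (r : ℕ) → r ≥ 1
    → (n : ℕ) → (G : Graph n)
    → (∀ j → j ≥ 1 → σ j ≤ tau σ φ r → ¬ HasCycle G (σ j))
    → (X : Subset n) → Nonempty X → (a : ℕ) → IsIndepNumber G X a
    → ∣ X ∣ ^ prod0 (tau σ φ) r
    < (27 ^ r * σ 1 * a) ^ prod0 (tau σ φ) r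
    * prod1 (λ i → delta σ φ i ^ (2 * coprod (tau σ φ) r (i ∸ 1))) r
    * n ^ (2 * coprod (tau σ φ) r r)
theorem7 σ φ σ-step 3≤σ₁ 1≤φ₁ φ-step σφ₁≡σ₁ (suc r) _ n G avoids X X≠∅ a (_ , α≤a) =
  decidable-stable (_ <? _) λ ¬goal → ¬¬-∀ (λ u → ¬¬-∀ λ v → ¬¬-excluded-middle) λ adj? →
    ¬goal (<-≤-trans (hasBound σ φ σ-step 3≤σ₁ 1≤φ₁ φ-step σφ₁≡σ₁ G adj? r avoids X X≠∅ a α≤a)
      (*-monoʳ-≤ factor (^-monoˡ-≤ (2 * coprod (tau σ φ) (suc r) (suc r)) (∣p∣≤n X))))
  where
  factor = (27 ^ suc r * σ 1 * a) ^ prod0 (tau σ φ) (suc r)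
    * prod1 (λ i → delta σ φ i ^ (2 * coprod (tau σ φ) (suc r) (i ∸ 1))) (suc r)
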